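{- Let $\mathcal X=([v],\{R_i\}_{i=0}^d)$ be a symmetric association scheme and let $A$ be an element of its Bose-Mesner algebra. Suppose that $|D_A(k)|=2$ for some positive integer $k$. Then, for every $a\in D_A(k)$, the hypergraph $\mathfrak H_A(v,k,a)$ is a partially balanced incomplete block design (PBIBD) on $\mathcal X$.
   Context: $[v]=\{1,\dots,v\}$. For a $v\times v$ matrix $A$ and $\alpha\subset[v]$, $A[\alpha]$ is the principal submatrix indexed by $\alpha$. $D_A(k)$ is the set of values $\det(A[\alpha])$ over all $k$-subsets $\alpha$ of $[v]$. $\mathfrak H_A(v,k,a)$ is the $k$-uniform hypergraph on $[v]$ whose hyperedges are the $k$-subsets $\alpha$ with $\det(A[\alpha])=a$. A symmetric association scheme with $d\ge1$ classes on a finite set $\mathfrak X$ is $(\mathfrak X,\{R_i\}_{i=0}^d)$, with $R_i$ nonempty subsets of $\mathfrak X\times\mathfrak X$ whose $\{0,1\}$ adjacency matrices $A_i$ (with $(A_i)_{xy}=1$ iff $(x,y)\in R_i$) satisfy: $A_0=I$; $\sum_{i=0}^dA_i=J$ (all-ones); $A_i^{\top}=A_i$ for all $i$; and every product $A_iA_j$ lies in the linear span of $A_0,\dots,A_d$. Its Bose-Mesner algebra is the algebra generated by $A_0,\dots,A_d$ over $\mathbb R$. A PBIBD on this scheme is a uniform hypergraph $(\mathfrak X,\mathfrak B)$ that is a $1$-design (every vertex lies in the same positive number of hyperedges) and such that for each $i\in\{1,\dots,d\}$ there is an integer $\lambda_i\geq0$ such that for every $(x,y)\in R_i$ the pair $\{x,y\}$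 is contained in exactly $\lambda_i$ hyperedges. -}

module Defs where

open import Level using (Level; 0ℓ; _⊔_)
open import Algebra.Bundles using (CommutativeRing)
import Algebra.Properties.Semiring.Exp as SemiringExp
import Algebra.Properties.Semiring.Sum as SemiringSum
open import Data.Bool.Base using (Bool; true; if_then_else_)
open import Data.Fin.Base using (Fin; zero; suc; toℕ; punchIn)
import Data.Fin.Properties as Fin
open import Data.Fin.Subset using (Subset; inside; outside; ∣_∣; _∈_)
open import Data.List.Base using (length)
import Data.List.Membership.Setoid as ListMembership
import Data.List.Relation.Unary.Unique.Setoid as ListUnique
open import Data.Nat.Base as ℕ using (ℕ; zero; suc)
import Data.Nat.Properties as ℕ
open import Data.Product.Base using (Σ-syntax; ∃-syntax; ∃₂; _×_; _,_)
open import Data.Rational.Base as ℚ using (ℚ; 0ℚ; 1ℚ; ½)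
import Data.Rational.Properties as ℚ
open import Data.Rational.Solver using (module +-*-Solver)
open import Data.Vec.Base using ([]; _∷_)
open import Function.Bundles using (_⇔_)
open import Relation.Binary.Bundles using (Setoid)
import Relation.Binary.PropositionalEquality as ≡
open ≡ using (_≡_; refl; cong; subst)
open import Relation.Nullary.Decidable using (⌊_⌋)
open import Relation.Unary using (Pred)

private
  variable
    c ℓ p : Level

------------------------------------------------------------------------
-- The real numbers, as Cauchy sequences of rationals

-- `Close s t` says both that s and t are Cauchy (take s = t) and that they
-- have the same limit; on Cauchy sequences it agrees with s n - t n → 0.
record Close (s t : ℕ → ℚ) : Set where
  constructor mkClose
  field
    approx : ∀ ε → 0ℚ ℚ.< ε →
      ∃[ N ] (∀ m n → N ℕ.≤ m → N ℕ.≤ n → ℚ.∣ s m ℚ.- t n ∣ ℚ.< ε)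

open Close public

record ℝ : Set where
  constructor mkℝ
  field
    seq    : ℕ → ℚ
    cauchy : Close seq seq

open ℝ public

infix 4 _≃_
record _≃_ (x y : ℝ) : Set where
  constructor mk≃
  field
    close : Close (seq x) (seq y)

open _≃_ public

private
  open +-*-Solver

  half-pos : ∀ {ε} → 0ℚ ℚ.< ε → 0ℚ ℚ.< ½ ℚ.* ε
  half-pos {ε} ε>0 =
    subst (ℚ._< ½ ℚ.* ε) (ℚ.*-zeroʳ ½) (ℚ.*-monoʳ-<-pos ½ ε>0)

  half+half : ∀ ε → ½ ℚ.* ε ℚ.+ ½ ℚ.* ε ≡ ε
  half+half ε = ≡.trans (≡.sym (ℚ.*-distribʳ-+ ε ½ ½)) (ℚ.*-identityˡ ε)

  -- If a is a sum of two terms, each below ε/2, then a is below ε.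
  split : ∀ {a b c ε} → a ≡ b ℚ.+ c →
          ℚ.∣ b ∣ ℚ.< ½ ℚ.* ε → ℚ.∣ c ∣ ℚ.< ½ ℚ.* ε → ℚ.∣ a ∣ ℚ.< ε
  split {b = b} {c} {ε} refl b< c< =
    ℚ.≤-<-trans (ℚ.∣p+q∣≤∣p∣+∣q∣ b c)
      (subst (ℚ.∣ b ∣ ℚ.+ ℚ.∣ c ∣ ℚ.<_) (half+half ε) (ℚ.+-mono-< b< c<))

  ∣-∣-swap : ∀ a b → ℚ.∣ a ℚ.- b ∣ ≡ ℚ.∣ b ℚ.- a ∣
  ∣-∣-swap a b = ≡.trans (≡.sym (ℚ.∣-p∣≡∣p∣ (a ℚ.- b)))
    (cong ℚ.∣_∣ (solve 2 (λ a b → :- (a :- b) := b :- a) refl a b))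

  Close-sym : ∀ {s t} → Close s t → Close t s
  Close-sym {s} {t} st .approx ε ε>0 = let N , h = approx st ε ε>0 in
    N , λ m n m≥ n≥ → subst (ℚ._< ε) (∣-∣-swap (s n) (t m)) (h n m n≥ m≥)

  Close-trans : ∀ {s t u} → Close s t → Close t u → Close s u
  Close-trans {s} {t} {u} st tu .approx ε ε>0 =
    let M , f = approx st (½ ℚ.* ε) (half-pos ε>0)
        N , g = approx tu (½ ℚ.* ε) (half-pos ε>0)
        K = M ℕ.⊔ N
        M≤K = ℕ.m≤m⊔n M N
        N≤K = ℕ.m≤n⊔m M N
    in K , λ m n m≥ n≥ →
      split (solve 3 (λ a b c → a :- c := (a :- b) :+ (b :- c)) refl
                   (s m) (t K) (u n))
            (f m K (ℕ.≤-trans M≤K m≥) M≤K)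
            (g K n N≤K (ℕ.≤-trans N≤K n≥))

  Close-≗ : ∀ {s t} → (∀ n → s n ≡ t n) → Close s s → Close s t
  Close-≗ {s} s≗t ss .approx ε ε>0 = let N , h = approx ss ε ε>0 in
    N , λ m n m≥ n≥ →
      subst (λ z → ℚ.∣ s m ℚ.- z ∣ ℚ.< ε) (s≗t n) (h m n m≥ n≥)

  Close-const : ∀ q → Close (λ _ → q) (λ _ → q)
  Close-const q .approx ε ε>0 = 0 , λ _ _ _ _ →
    subst (λ z → ℚ.∣ z ∣ ℚ.< ε) (≡.sym (ℚ.+-inverseʳ q)) ε>0

  Close-+ : ∀ {s s′ t t′} → Close s s′ → Close t t′ →
            Close (λ n → s n ℚ.+ t n) (λ n → s′ n ℚ.+ t′ n)
  Close-+ {s} {s′} {t} {t′} ss tt .approx ε ε>0 =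
    let M , f = approx ss (½ ℚ.* ε) (half-pos ε>0)
        N , g = approx tt (½ ℚ.* ε) (half-pos ε>0)
        M≤K = ℕ.m≤m⊔n M N
        N≤K = ℕ.m≤n⊔m M N
    in M ℕ.⊔ N , λ m n m≥ n≥ →
      split (solve 4 (λ a b c d →
                        (a :+ b) :- (c :+ d) := (a :- c) :+ (b :- d)) refl
                   (s m) (t m) (s′ n) (t′ n))
            (f m n (ℕ.≤-trans M≤K m≥) (ℕ.≤-trans M≤K n≥))
            (g m n (ℕ.≤-trans N≤K m≥) (ℕ.≤-trans N≤K n≥))

  Close-neg : ∀ {s t} → Close s t → Close (λ n → ℚ.- s n) (λ n → ℚ.- t n)
  Close-neg {s} {t} st .approx ε ε>0 = let N , h = approx st ε ε>0 in
    N , λ m n m≥ n≥ →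
      subst (ℚ._< ε)
        (≡.trans (∣-∣-swap (s m) (t n))
          (cong ℚ.∣_∣ (solve 2 (λ a b → b :- a := (:- a) :- (:- b)) refl
                             (s m) (t n))))
        (h m n m≥ n≥)

  EventuallyBounded : (ℕ → ℚ) → Set
  EventuallyBounded s =
    ∃[ B ] 0ℚ ℚ.< B × ∃[ N ] (∀ n → N ℕ.≤ n → ℚ.∣ s n ∣ ℚ.≤ B)

  bounded : ∀ {s} → Close s s → EventuallyBounded s
  bounded {s} ss =
    let N , h = approx ss 1ℚ (ℚ.positive⁻¹ 1ℚ)
        b = ℚ.∣ s N ∣
        1≤1+b : 1ℚ ℚ.≤ 1ℚ ℚ.+ b
        1≤1+b = subst (ℚ._≤ 1ℚ ℚ.+ b) (ℚ.+-identityʳ 1ℚ)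
                  (ℚ.+-monoʳ-≤ 1ℚ (ℚ.0≤∣p∣ (s N)))
    in 1ℚ ℚ.+ b , ℚ.<-≤-trans (ℚ.positive⁻¹ 1ℚ) 1≤1+b , N , λ n n≥ →
      subst (λ z → ℚ.∣ z ∣ ℚ.≤ 1ℚ ℚ.+ b)
        (solve 2 (λ a b → (a :- b) :+ b := a) refl (s n) (s N))
        (ℚ.≤-trans (ℚ.∣p+q∣≤∣p∣+∣q∣ (s n ℚ.- s N) (s N))
          (ℚ.+-monoˡ-≤ b (ℚ.<⇒≤ (h n N n≥ ℕ.≤-refl))))

  shrink : ∀ {B ε} → 0ℚ ℚ.< B → 0ℚ ℚ.< ε →
           ∃[ δ ] 0ℚ ℚ.< δ ×
             (∀ a b → ℚ.∣ a ∣ ℚ.≤ B → ℚ.∣ b ∣ ℚ.< δ → ℚ.∣ a ℚ.* b ∣ ℚ.< ε)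
  shrink {B} {ε} B>0 ε>0 =
    δ , δ>0 , λ a b a≤ b< →
      subst (ℚ._< ε) (≡.sym (ℚ.∣p*q∣≡∣p∣*∣q∣ a b))
        (ℚ.≤-<-trans
          (ℚ.*-monoʳ-≤-nonNeg ℚ.∣ b ∣ {{ℚ.∣-∣-nonNeg b}} a≤)
          (subst (B ℚ.* ℚ.∣ b ∣ ℚ.<_) B*δ≡ε (ℚ.*-monoʳ-<-pos B b<)))
    where
    instance
      B-pos : ℚ.Positive B
      B-pos = ℚ.positive B>0
      B-nonZero : ℚ.NonZero B
      B-nonZero = ℚ.pos⇒nonZero B
      1/B-pos : ℚ.Positive (ℚ.1/ B)
      1/B-pos = ℚ.1/pos⇒pos B
    δ : ℚ
    δ = (ℚ.1/ B) ℚ.* ε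
    δ>0 : 0ℚ ℚ.< δ
    δ>0 = subst (ℚ._< δ) (ℚ.*-zeroʳ (ℚ.1/ B)) (ℚ.*-monoʳ-<-pos (ℚ.1/ B) ε>0)
    B*δ≡ε : B ℚ.* δ ≡ ε
    B*δ≡ε = ≡.trans (≡.sym (ℚ.*-assoc B (ℚ.1/ B) ε))
      (≡.trans (cong (ℚ._* ε) (ℚ.*-inverseʳ B)) (ℚ.*-identityˡ ε))

  Close-* : ∀ {s s′ t t′} → Close s s′ → Close t t′ →
            Close (λ n → s n ℚ.* t n) (λ n → s′ n ℚ.* t′ n)
  Close-* {s} {s′} {t} {t′} ss tt .approx ε ε>0 =
    let B , B>0 , P , bs = bounded (Close-trans ss (Close-sym ss))
        C , C>0 , Q , bt = bounded (Close-trans (Close-sym tt) tt)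
        δ , δ>0 , F = shrink B>0 (half-pos ε>0)
        η , η>0 , G = shrink C>0 (half-pos ε>0)
        M , f = approx tt δ δ>0
        N , g = approx ss η η>0
        P≤ = ℕ.≤-trans (ℕ.m≤m⊔n P Q) (ℕ.m≤m⊔n (P ℕ.⊔ Q) (M ℕ.⊔ N))
        Q≤ = ℕ.≤-trans (ℕ.m≤n⊔m P Q) (ℕ.m≤m⊔n (P ℕ.⊔ Q) (M ℕ.⊔ N))
        M≤ = ℕ.≤-trans (ℕ.m≤m⊔n M N) (ℕ.m≤n⊔m (P ℕ.⊔ Q) (M ℕ.⊔ N))
        N≤ = ℕ.≤-trans (ℕ.m≤n⊔m M N) (ℕ.m≤n⊔m (P ℕ.⊔ Q) (M ℕ.⊔ N))
    in (P ℕ.⊔ Q) ℕ.⊔ (M ℕ.⊔ N) , λ m n m≥ n≥ →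
      split (solve 4 (λ a b c d →
                        (a :* b) :- (c :* d)
                          := (a :* (b :- d)) :+ (d :* (a :- c))) refl
                   (s m) (t m) (s′ n) (t′ n))
            (F (s m) (t m ℚ.- t′ n) (bs m (ℕ.≤-trans P≤ m≥))
               (f m n (ℕ.≤-trans M≤ m≥) (ℕ.≤-trans M≤ n≥)))
            (G (t′ n) (s m ℚ.- s′ n) (bt n (ℕ.≤-trans Q≤ n≥))
               (g m n (ℕ.≤-trans N≤ m≥) (ℕ.≤-trans N≤ n≥)))

infixl 6 _+ʳ_
infixl 7 _*ʳ_
infix  8 -ʳ_

_+ʳ_ _*ʳ_ : ℝ → ℝ → ℝ
x +ʳ y = mkℝ (λ n → seq x n ℚ.+ seq y n) (Close-+ (cauchy x) (cauchy y))
x *ʳ y = mkℝ (λ n → seq x n ℚ.* seq y n) (Close-* (cauchy x) (cauchy y))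

-ʳ_ : ℝ → ℝ
-ʳ x = mkℝ (λ n → ℚ.- seq x n) (Close-neg (cauchy x))

0ʳ 1ʳ : ℝ
0ʳ = mkℝ (λ _ → 0ℚ) (Close-const 0ℚ)
1ʳ = mkℝ (λ _ → 1ℚ) (Close-const 1ℚ)

private
  ≗⇒≃ : ∀ x y → (∀ n → seq x n ≡ seq y n) → x ≃ y
  ≗⇒≃ x y h = mk≃ (Close-≗ h (cauchy x))

ℝ-commutativeRing : CommutativeRing 0ℓ 0ℓ
ℝ-commutativeRing = record
  { Carrier = ℝ
  ; _≈_ = _≃_
  ; _+_ = _+ʳ_
  ; _*_ = _*ʳ_
  ; -_  = -ʳ_
  ; 0#  = 0ʳ
  ; 1#  = 1ʳ
  ; isCommutativeRing = record
    { isRing = record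
      { +-isAbelianGroup = record
        { isGroup = record
          { isMonoid = record
            { isSemigroup = record
              { isMagma = record
                { isEquivalence = record
                  { refl  = λ {x} → mk≃ (cauchy x)
                  ; sym   = λ p → mk≃ (Close-sym (close p))
                  ; trans = λ p q → mk≃ (Close-trans (close p) (close q))
                  }
                ; ∙-cong = λ p q → mk≃ (Close-+ (close p) (close q))
                }
              ; assoc = λ x y z → ≗⇒≃ ((x +ʳ y) +ʳ z) (x +ʳ (y +ʳ z))
                  λ n → ℚ.+-assoc (seq x n) (seq y n) (seq z n)
              }
            ; identity =
                (λ x → ≗⇒≃ (0ʳ +ʳ x) x λ n → ℚ.+-identityˡ (seq x n))
              , (λ x → ≗⇒≃ (x +ʳ 0ʳ) x λ n → ℚ.+-identityʳ (seq x n))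
            }
          ; inverse =
              (λ x → ≗⇒≃ (-ʳ x +ʳ x) 0ʳ λ n → ℚ.+-inverseˡ (seq x n))
            , (λ x → ≗⇒≃ (x +ʳ -ʳ x) 0ʳ λ n → ℚ.+-inverseʳ (seq x n))
          ; ⁻¹-cong = λ p → mk≃ (Close-neg (close p))
          }
        ; comm = λ x y → ≗⇒≃ (x +ʳ y) (y +ʳ x)
            λ n → ℚ.+-comm (seq x n) (seq y n)
        }
      ; *-cong = λ p q → mk≃ (Close-* (close p) (close q))
      ; *-assoc = λ x y z → ≗⇒≃ ((x *ʳ y) *ʳ z) (x *ʳ (y *ʳ z))
          λ n → ℚ.*-assoc (seq x n) (seq y n) (seq z n)
      ; *-identity =
          (λ x → ≗⇒≃ (1ʳ *ʳ x) x λ n → ℚ.*-identityˡ (seq x n))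
        , (λ x → ≗⇒≃ (x *ʳ 1ʳ) x λ n → ℚ.*-identityʳ (seq x n))
      ; distrib =
          (λ x y z → ≗⇒≃ (x *ʳ (y +ʳ z)) (x *ʳ y +ʳ x *ʳ z)
            λ n → ℚ.*-distribˡ-+ (seq x n) (seq y n) (seq z n))
        , (λ x y z → ≗⇒≃ ((y +ʳ z) *ʳ x) (y *ʳ x +ʳ z *ʳ x)
            λ n → ℚ.*-distribʳ-+ (seq x n) (seq y n) (seq z n))
      }
    ; *-comm = λ x y → ≗⇒≃ (x *ʳ y) (y *ʳ x)
        λ n → ℚ.*-comm (seq x n) (seq y n)
    }
  }

------------------------------------------------------------------------
-- Cardinality and hypergraphs

-- The subset P of S (taken up to the equality of S) has exactly n elements.
HasSize : (S : Setoid c ℓ) → Pred (Setoid.Carrier S) p → ℕ → Set _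
HasSize S P n =
  ∃[ xs ] Unique xs × length xs ≡ n × (∀ x → P x ⇔ x ∈ₗ xs)
  where
  open ListMembership S renaming (_∈_ to _∈ₗ_)
  open ListUnique S using (Unique)

Hypergraph : ℕ → (ℓ : Level) → Set _
Hypergraph v ℓ = Pred (Subset v) ℓ

-- Exactly n of the hyperedges satisfy P.
HyperedgesWith : ∀ {v} → Hypergraph v ℓ → Pred (Subset v) 0ℓ → ℕ → Set _
HyperedgesWith {v = v} 𝔅 P = HasSize (≡.setoid (Subset v)) (λ α → 𝔅 α × P α)

Uniform : ∀ {v} → ℕ → Hypergraph v ℓ → Set _
Uniform k 𝔅 = ∀ α → 𝔅 α → ∣ α ∣ ≡ k

record IsOneDesign {v} (𝔅 : Hypergraph v ℓ) : Set ℓ where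
  field
    r           : ℕ
    r>0         : 0 ℕ.< r
    replication : ∀ x → HyperedgesWith 𝔅 (λ α → x ∈ α) r

-- The increasing enumeration of the elements of a subset.
element : ∀ {v} (α : Subset v) → Fin ∣ α ∣ → Fin v
element (inside  ∷ α) zero    = zero
element (inside  ∷ α) (suc i) = suc (element α i)
element (outside ∷ α) i       = suc (element α i)

------------------------------------------------------------------------
-- Matrices, symmetric association schemes and PBIBDs. The ring of scalars is
-- a parameter; the scalars of interest are the real numbers.

module Scalars {c ℓ} (K : CommutativeRing c ℓ) where
  open CommutativeRing K
    using (Carrier; _≈_; _+_; _*_; -_; 0#; 1#; semiring)
  open SemiringExp semiring using (_^_)
  open SemiringSum semiring using (sum)

  Matrix : ℕ → Set c
  Matrix n = Fin n → Fin n → Carrier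

  infix  4 _≈ᴹ_
  infixl 6 _+ᴹ_
  infixl 7 _*ᴹ_ _•_

  _≈ᴹ_ : ∀ {n} → Matrix n → Matrix n → Set ℓ
  M ≈ᴹ N = ∀ x y → M x y ≈ N x y

  _+ᴹ_ _*ᴹ_ : ∀ {n} → Matrix n → Matrix n → Matrix n
  (M +ᴹ N) x y = M x y + N x y
  (M *ᴹ N) x y = sum (λ z → M x z * N z y)

  _•_ : ∀ {n} → Carrier → Matrix n → Matrix n
  (a • M) x y = a * M x y

  _ᵀ : ∀ {n} → Matrix n → Matrix n
  (M ᵀ) x y = M y x

  I J : ∀ {n} → Matrix n
  I x y = if ⌊ x Fin.≟ y ⌋ then 1# else 0#
  J x y = 1#

  ∑ᴹ : ∀ {m n} → (Fin m → Matrix n) → Matrix n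
  ∑ᴹ M x y = sum (λ i → M i x y)

  -- Laplace expansion along the first row.
  det : ∀ {n} → Matrix n → Carrier
  det {zero}  M = 1#
  det {suc n} M = sum λ j →
    (- 1#) ^ toℕ j * M zero j * det (λ x y → M (suc x) (punchIn j y))

  infix 9 _[_]
  _[_] : ∀ {v} → Matrix v → (α : Subset v) → Matrix ∣ α ∣
  (A [ α ]) x y = A (element α x) (element α y)

  D : ∀ {v} → Matrix v → ℕ → Pred Carrier ℓ
  D A k a = ∃[ α ] ∣ α ∣ ≡ k × det (A [ α ]) ≈ a

  ℌ : ∀ {v} → Matrix v → ℕ → Carrier → Hypergraph v ℓ
  ℌ A k a α = ∣ α ∣ ≡ k × det (A [ α ]) ≈ a

  record SymmetricScheme (v d : ℕ) : Set (c ⊔ ℓ) where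
    field
      R : Fin (suc d) → Fin v → Fin v → Bool

    Adj : Fin (suc d) → Matrix v
    Adj i x y = if R i x y then 1# else 0#

    field
      d≥1       : 1 ℕ.≤ d
      nonempty  : ∀ i → ∃₂ λ x y → R i x y ≡ true
      diagonal  : Adj zero ≈ᴹ I
      partition : ∑ᴹ Adj ≈ᴹ J
      symmetric : ∀ i → Adj i ᵀ ≈ᴹ Adj i
      product   : ∀ i j →
        Σ[ q ∈ (Fin (suc d) → Carrier) ] Adj i *ᴹ Adj j ≈ᴹ ∑ᴹ (λ h → q h • Adj h)

  module _ {v d : ℕ} (𝒳 : SymmetricScheme v d) where
    open SymmetricScheme 𝒳 using (R; Adj)

    -- The algebra generated by the adjacency matrices; the unit I is Adj zero.
    data BoseMesner : Matrix v → Set (c ⊔ ℓ) where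
      gen  : ∀ i → BoseMesner (Adj i)
      add  : ∀ {M N} → BoseMesner M → BoseMesner N → BoseMesner (M +ᴹ N)
      mul  : ∀ {M N} → BoseMesner M → BoseMesner N → BoseMesner (M *ᴹ N)
      scal : ∀ a {M} → BoseMesner M → BoseMesner (a • M)
      resp : ∀ {M N} → M ≈ᴹ N → BoseMesner M → BoseMesner N

    -- The nontrivial relations R₁, …, R_d are R (suc i) for i : Fin d.
    record IsPBIBD {ℓ′} (𝔅 : Hypergraph v ℓ′) : Set ℓ′ where
      field
        k           : ℕ
        uniform     : Uniform k 𝔅
        isOneDesign : IsOneDesign 𝔅
        Λ           : Fin d → ℕ
        balanced    : ∀ i x y → R (suc i) x y ≡ true →
          HyperedgesWith 𝔅 (λ α → x ∈ α × y ∈ α) (Λ i)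

{-# OPTIONS --safe #-}
module Submission where

open import Defs
open import Algebra.Bundles using (CommutativeRing)
import Algebra.Properties.AbelianGroup as AbelianGroupProperties
import Algebra.Properties.Ring as RingProperties
import Algebra.Properties.Semiring.Exp as SemiringExp
import Algebra.Properties.Semiring.Mult as SemiringMult
import Algebra.Properties.Semiring.Sum as SemiringSum
import Algebra.Solver.Ring.NaturalCoefficients.Default as RingSolver
open import Data.Bool.Base using (Bool; true; false; if_then_else_)
open import Data.Empty using (⊥)
open import Data.Fin.Base using (Fin; zero; suc; toℕ; punchIn; cast)
import Data.Fin.Properties as Fin
open import Data.Fin.Subset using (Subset; inside; outside; ∣_∣; _∈_; ⊤)
open import Data.Fin.Subset.Properties
  using (_∈?_; nonempty?; Empty-unique; ∣⊥∣≡0; ∣⊤∣≡n)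
open import Data.List.Base using (List; []; _∷_; _++_; map; filter; length)
import Data.List.Membership.Propositional as List
open import Data.List.Membership.Propositional.Properties
  using (∈-map⁺; ∈-map⁻; ∈-++⁺ˡ; ∈-++⁺ʳ; ∈-filter⁺; ∈-filter⁻)
open import Data.List.Properties using (filter-++; length-++)
open import Data.List.Relation.Unary.All using ([]; _∷_)
open import Data.List.Relation.Unary.AllPairs using ([]; _∷_)
open import Data.List.Relation.Unary.Any using (here; there)
open import Data.List.Relation.Unary.Unique.Propositional using (Unique)
import Data.List.Relation.Unary.Unique.Propositional.Properties as Unique
open import Data.Nat.Base as ℕ using (ℕ; zero; suc; _≤_; _<_; z≤n; s≤s)
import Data.Nat.Properties as ℕ
open import Data.Product.Base using (∃-syntax; _×_; _,_; proj₁)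
open import Data.Rational.Base as ℚ using (0ℚ; 1ℚ)
import Data.Rational.Properties as ℚ
open import Data.Sum.Base using (_⊎_; inj₁; inj₂)
open import Data.Vec.Base as Vec using ([]; _∷_; insertAt; lookup)
open import Data.Vec.Functional using (Vector; updateAt) renaming (_∷_ to _∷ᶠ_)
open import Data.Vec.Functional.Properties
  using (updateAt-updates; updateAt-minimal; updateAt-commutes; updateAt-updateAt)
open import Data.Vec.Properties
  using (insertAt-lookup; insertAt-punchIn; lookup-replicate; lookup⇒[]=; []=⇒lookup; ∷-injectiveʳ)
open import Function.Base using (_∘_; const)
open import Function.Bundles using (mk⇔; Equivalence)
open import Level using (_⊔_)
import Relation.Binary.PropositionalEquality as ≡
open ≡ using (_≡_; _≢_)
import Relation.Binary.Reasoning.Setoid as SetoidReasoning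
open import Relation.Nullary using (¬_; Dec; does; yes; no; contradiction; _×-dec_)
open import Relation.Unary using (Pred; Decidable)

-- With B = I + tA over the ring of formal power series in t, the determinant of
-- B after replacing rows x and y by those of tA is Σ t^|α| det A[α] over the
-- α containing x and y. Writing the rows of tA as combinations of the rows of
-- B with coefficients H = tA(I + tA)⁻¹, it is also
-- det B · (H x x · H y y − H x y · H y x) for x ≠ y, and det B · H x x for
-- x = y. The coefficients of H lie in the Bose-Mesner algebra, so the sum of
-- det A[α] over the k-subsets α containing x and y depends only on the relation
-- of x and y. If these determinants take only the values a ≠ b, subtracting b times
-- the same sum for the identity matrix leaves (a − b) times the number of
-- hyperedges through x and y.

-- Over power series `I + tA` is invertible for every `A`: the geometric series gives `H` the
-- coefficients ± powers of `A`, which is what places them in the algebra. Zeroing the identity part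
-- of rows x and y is what forces x and y into α. The factor det B is the same for all pairs, so it
-- is neither inverted nor computed; only the four entries of `H` at x and y matter. The entry at (y
-- , x) is tied to the relation of (x , y) by the symmetry of the matrices in the span.
--
-- Determinants are needed both over the scalars and over their power series, hence their theory is
-- developed over an arbitrary commutative ring, without division.
--
-- Constructively, a ≉ b for Cauchy reals does not provide an inverse of a - b. The last step
-- therefore compares natural multiples of a - b, and torsion-freeness together with a ≉ b is enough
-- to equate the counts. Equality of reals is not decidable either; the two-value hypothesis is what
-- decides which k-subsets are hyperedges.

updateAt-elim : ∀ {a p} {A : Set a} {n} (xs : Vector A n) (x : Fin n) (r : A)
                (P : Fin n → A → Set p) → P x r → (∀ i → i ≢ x → P i (xs i)) →
                ∀ i → P i (updateAt xs x (const r) i)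
updateAt-elim xs x r P Pr Pxs i with i Fin.≟ x
... | yes ≡.refl = ≡.subst (P i) (≡.sym (updateAt-updates i xs)) Pr
... | no i≢x     = ≡.subst (P i) (≡.sym (updateAt-minimal i x xs i≢x)) (Pxs i i≢x)

-- Deleting j and then k leaves the same indices as deleting punchIn j k and
-- then other j k.
other : ∀ {n} → Fin (suc n) → Fin n → Fin n
other {suc n} zero    k       = zero
other {suc n} (suc j) zero    = j
other {suc n} (suc j) (suc k) = suc (other j k)

punchIn-other : ∀ {n} (j : Fin (suc n)) k → punchIn (punchIn j k) (other j k) ≡ j
punchIn-other {suc n} zero    k       = ≡.refl
punchIn-other {suc n} (suc j) zero    = ≡.refl
punchIn-other {suc n} (suc j) (suc k) = ≡.cong suc (punchIn-other j k)

punchIn-punchIn : ∀ {n} (j : Fin (suc (suc n))) k l →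
                  punchIn j (punchIn k l) ≡ punchIn (punchIn j k) (punchIn (other j k) l)
punchIn-punchIn zero    k       l       = ≡.refl
punchIn-punchIn (suc j) zero    l       = ≡.refl
punchIn-punchIn (suc j) (suc k) zero    = ≡.refl
punchIn-punchIn (suc j) (suc k) (suc l) = ≡.cong suc (punchIn-punchIn j k l)

-- Determinants over a commutative ring: linear and alternating in the rows.

module Determinant {c ℓ} (K : CommutativeRing c ℓ) where
  open CommutativeRing K hiding (zero)
  open Scalars K using (Matrix; _≈ᴹ_; det)
  open SemiringSum semiring
    using (sum; sum-cong-≋; sum-replicate-zero; ∑-distrib-+; *-distribˡ-sum)
  open SemiringExp semiring using (_^_)
  open RingProperties ring using (-1*x≈-x)
  open AbelianGroupProperties +-abelianGroup using (inverseˡ-unique)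
  open SetoidReasoning setoid
  open RingSolver commutativeSemiring using (solve; _:=_; _:+_; _:*_)

  ≡⇒≋ : ∀ {n} {r s : Vector Carrier n} → r ≡ s → ∀ j → r j ≈ s j
  ≡⇒≋ ≡.refl j = refl

  sum-zero : ∀ {n} {f : Vector Carrier n} → (∀ i → f i ≈ 0#) → sum f ≈ 0#
  sum-zero {n} f≈0 = trans (sum-cong-≋ f≈0) (sum-replicate-zero n)

  sum-only : ∀ {n} {f : Vector Carrier n} x → (∀ i → i ≢ x → f i ≈ 0#) → sum f ≈ f x
  sum-only zero    h = trans (+-congˡ (sum-zero λ i → h (suc i) λ ())) (+-identityʳ _)
  sum-only (suc x) h = trans
    (+-cong (h zero λ ()) (sum-only x λ i i≢x → h (suc i) (i≢x ∘ Fin.suc-injective)))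
    (+-identityˡ _)

  record IsLinear {m} (φ : Vector Carrier m → Carrier) : Set (c ⊔ ℓ) where
    field
      cong   : ∀ {r s} → (∀ i → r i ≈ s i) → φ r ≈ φ s
      +-homo : ∀ r s → φ (λ i → r i + s i) ≈ φ r + φ s
      *-homo : ∀ a r → φ (λ i → a * r i) ≈ a * φ r

    0-homo : φ (λ _ → 0#) ≈ 0#
    0-homo = begin
      φ (λ _ → 0#)      ≈⟨ cong (λ _ → zeroˡ 0#) ⟨
      φ (λ _ → 0# * 0#) ≈⟨ *-homo 0# _ ⟩
      0# * φ (λ _ → 0#) ≈⟨ zeroˡ _ ⟩
      0#                ∎

    sum-homo : ∀ {k} (a : Vector Carrier k) (r : Fin k → Vector Carrier m) →
               φ (λ i → sum λ z → a z * r z i) ≈ sum (λ z → a z * φ (r z))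
    sum-homo {zero}  a r = 0-homo
    sum-homo {suc k} a r =
      trans (+-homo _ _) (+-cong (*-homo _ _) (sum-homo (a ∘ suc) (r ∘ suc)))

  sum-isLinear : ∀ {k m} {φ : Fin k → Vector Carrier m → Carrier} →
                 (∀ j → IsLinear (φ j)) → IsLinear (λ r → sum λ j → φ j r)
  sum-isLinear {φ = φ} lin = record
    { cong   = λ r≈s → sum-cong-≋ λ j → IsLinear.cong (lin j) r≈s
    ; +-homo = λ r s → trans (sum-cong-≋ λ j → IsLinear.+-homo (lin j) r s)
                             (∑-distrib-+ (λ j → φ j r) (λ j → φ j s))
    ; *-homo = λ a r → trans (sum-cong-≋ λ j → IsLinear.*-homo (lin j) a r)
                             (sym (*-distribˡ-sum a (λ j → φ j r)))
    }

  -- Shaped like a Laplace term: the varying row enters either through the entry, with the minor as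
  -- the right factor, or through the minor, with right factor `1#`.
  *-isLinear : ∀ {m} {φ : Vector Carrier m → Carrier} a b → IsLinear φ → IsLinear (λ r → a * φ r * b)
  *-isLinear {φ = φ} a b lin = record
    { cong   = λ r≈s → *-congʳ (*-congˡ (IsLinear.cong lin r≈s))
    ; +-homo = λ r s → trans (*-congʳ (*-congˡ (IsLinear.+-homo lin r s)))
        (solve 4 (λ a b x y → a :* (x :+ y) :* b := a :* x :* b :+ a :* y :* b) refl a b (φ r) (φ s))
    ; *-homo = λ e r → trans (*-congʳ (*-congˡ (IsLinear.*-homo lin e r)))
        (solve 4 (λ a b e x → a :* (e :* x) :* b := e :* (a :* x :* b)) refl a b e (φ r))
    }

  lookup-isLinear : ∀ {m} (j : Fin m) → IsLinear (λ r → r j)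
  lookup-isLinear j = record
    { cong = λ r≈s → r≈s j ; +-homo = λ _ _ → refl ; *-homo = λ _ _ → refl }

  isLinear-resp : ∀ {m} {φ ψ : Vector Carrier m → Carrier} → (∀ r → φ r ≈ ψ r) → IsLinear ψ → IsLinear φ
  isLinear-resp φ≈ψ lin = record
    { cong   = λ r≈s → trans (φ≈ψ _) (trans (IsLinear.cong lin r≈s) (sym (φ≈ψ _)))
    ; +-homo = λ r s → trans (φ≈ψ _) (trans (IsLinear.+-homo lin r s) (sym (+-cong (φ≈ψ r) (φ≈ψ s))))
    ; *-homo = λ a r → trans (φ≈ψ _) (trans (IsLinear.*-homo lin a r) (sym (*-congˡ (φ≈ψ r))))
    }

  ∘-isLinear : ∀ {m n} {φ : Vector Carrier m → Carrier} (f : Fin m → Fin n) →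
               IsLinear φ → IsLinear (λ r → φ (r ∘ f))
  ∘-isLinear f lin = record
    { cong   = λ r≈s → IsLinear.cong lin (r≈s ∘ f)
    ; +-homo = λ r s → IsLinear.+-homo lin (r ∘ f) (s ∘ f)
    ; *-homo = λ a r → IsLinear.*-homo lin a (r ∘ f)
    }

  _[_≔_] : ∀ {m n} → (Fin m → Vector Carrier n) → Fin m → Vector Carrier n → Fin m → Vector Carrier n
  M [ x ≔ r ] = updateAt M x (const r)

  sgn : ∀ {n} → Fin n → Carrier
  sgn j = (- 1#) ^ toℕ j

  minor₀ : ∀ {m n} → (Fin (suc m) → Vector Carrier (suc n)) → Fin (suc n) → Fin m → Vector Carrier n
  minor₀ M j x y = M (suc x) (punchIn j y)

  det-cong : ∀ {n} {M N : Matrix n} → M ≈ᴹ N → det M ≈ det N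
  det-cong {zero}  M≈N = refl
  det-cong {suc n} M≈N = sum-cong-≋ λ j →
    *-cong (*-congˡ {sgn j} (M≈N zero j)) (det-cong λ x y → M≈N (suc x) (punchIn j y))

  det-isLinear : ∀ {n} (M : Matrix n) x → IsLinear (λ r → det (M [ x ≔ r ]))
  det-isLinear M zero = sum-isLinear λ j → *-isLinear (sgn j) (det (minor₀ M j)) (lookup-isLinear j)
  det-isLinear {suc n} M (suc x) = sum-isLinear λ j → isLinear-resp (commute j)
    (*-isLinear (sgn j * M zero j) 1# (∘-isLinear (punchIn j) (det-isLinear (minor₀ M j) x)))
    where
    commute : ∀ j r → sgn j * M zero j * det (minor₀ (M [ suc x ≔ r ]) j) ≈
                      sgn j * M zero j * det (minor₀ M j [ x ≔ r ∘ punchIn j ]) * 1#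
    commute j r = trans (*-congˡ (det-cong (updateAt-elim (M ∘ suc) x r
        (λ i s → ∀ y → s (punchIn j y) ≈ (minor₀ M j [ x ≔ r ∘ punchIn j ]) i y)
        (λ y → ≡⇒≋ (≡.sym (updateAt-updates x (minor₀ M j))) y)
        (λ i i≢x y → ≡⇒≋ (≡.sym (updateAt-minimal i x (minor₀ M j) i≢x)) y))))
      (sym (*-identityʳ _))

  -- The two index pairs are the two orders of deleting the same two columns. Deleting the smaller
  -- column first lowers the index of the larger one by one, while the opposite order leaves the
  -- smaller one alone, so the signs are opposite.
  sgn-other : ∀ {n} (j : Fin (suc n)) k →
              sgn j * sgn k + sgn (punchIn j k) * sgn (other j k) ≈ 0#
  sgn-other {suc n} zero k = begin
    1# * sgn k + - 1# * sgn k * 1# ≈⟨ +-cong (*-identityˡ _) (*-identityʳ _) ⟩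
    sgn k + - 1# * sgn k           ≈⟨ +-congˡ (-1*x≈-x _) ⟩
    sgn k + - sgn k                ≈⟨ -‿inverseʳ _ ⟩
    0#                             ∎
  sgn-other {suc n} (suc j) zero = begin
    - 1# * sgn j * 1# + 1# * sgn j ≈⟨ +-cong (*-identityʳ _) (*-identityˡ _) ⟩
    - 1# * sgn j + sgn j           ≈⟨ +-congʳ (-1*x≈-x _) ⟩
    - sgn j + sgn j                ≈⟨ -‿inverseˡ _ ⟩
    0#                             ∎
  sgn-other {suc n} (suc j) (suc k) = begin
    - 1# * sgn j * (- 1# * sgn k) + - 1# * sgn (punchIn j k) * (- 1# * sgn (other j k))
      ≈⟨ solve 5 (λ m a b e f → m :* a :* (m :* b) :+ m :* e :* (m :* f) := m :* m :* (a :* b :+ e :* f))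
               refl (- 1#) (sgn j) (sgn k) (sgn (punchIn j k)) (sgn (other j k)) ⟩
    - 1# * - 1# * (sgn j * sgn k + sgn (punchIn j k) * sgn (other j k))
      ≈⟨ *-congˡ (sgn-other j k) ⟩
    - 1# * - 1# * 0# ≈⟨ zeroʳ _ ⟩
    0# ∎

  -- The index pairs are matched by a fixed-point-free involution. The induction cancels the pairs
  -- (zero , k) against (suc k , zero) and recurses on the remaining pairs (suc j , suc k), on which
  -- `punchIn` and `other` act in the same way.
  sum-cancel : ∀ {n} (G : Fin (suc n) → Fin n → Carrier) →
               (∀ j k → G j k + G (punchIn j k) (other j k) ≈ 0#) →
               sum (λ j → sum (G j)) ≈ 0#
  sum-cancel {zero}  G h = +-identityʳ 0#
  sum-cancel {suc n} G h = begin
    sum (G zero) + sum (λ j → G (suc j) zero + sum (λ k → G (suc j) (suc k)))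
      ≈⟨ +-congˡ (∑-distrib-+ (λ j → G (suc j) zero) (λ j → sum (λ k → G (suc j) (suc k)))) ⟩
    sum (G zero) + (sum (λ j → G (suc j) zero) + sum (λ j → sum (λ k → G (suc j) (suc k))))
      ≈⟨ +-assoc _ _ _ ⟨
    sum (G zero) + sum (λ j → G (suc j) zero) + sum (λ j → sum (λ k → G (suc j) (suc k)))
      ≈⟨ +-cong (sym (∑-distrib-+ (G zero) (λ j → G (suc j) zero)))
                (sum-cancel (λ j k → G (suc j) (suc k)) λ j k → h (suc j) (suc k)) ⟩
    sum (λ k → G zero k + G (suc k) zero) + 0#
      ≈⟨ +-congʳ (sum-zero λ k → h zero k) ⟩
    0# + 0# ≈⟨ +-identityʳ 0# ⟩
    0# ∎

  -- After expansion along both rows, the two orders of choosing a pair of columns leave the same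
  -- minor and, since the rows agree, the same product of entries, with opposite signs.
  det-rows₀₁ : ∀ {n} (M : Matrix (suc (suc n))) → (∀ j → M zero j ≈ M (suc zero) j) → det M ≈ 0#
  det-rows₀₁ {n} M M₀≈M₁ = begin
    det M
      ≈⟨ (sum-cong-≋ λ j → *-distribˡ-sum (sgn j * M zero j) λ k → sgn k * M (suc zero) (punchIn j k) * d j k) ⟩
    sum (λ j → sum (G j))
      ≈⟨ sum-cancel G cancel ⟩
    0# ∎
    where
    d : Fin (suc (suc n)) → Fin (suc n) → Carrier
    d j k = det (minor₀ (minor₀ M j) k)

    G : Fin (suc (suc n)) → Fin (suc n) → Carrier
    G j k = sgn j * M zero j * (sgn k * M (suc zero) (punchIn j k) * d j k)

    cancel : ∀ j k → G j k + G (punchIn j k) (other j k) ≈ 0#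
    cancel j k = begin
      G j k + sgn j′ * M zero j′ * (sgn k′ * M (suc zero) (punchIn j′ k′) * d j′ k′)
        ≈⟨ +-congˡ (*-cong (*-congˡ (M₀≈M₁ j′)) (*-cong
             (*-congˡ (trans (reflexive (≡.cong (M (suc zero)) (punchIn-other j k))) (sym (M₀≈M₁ j))))
             (det-cong λ x y → reflexive (≡.cong (M (suc (suc x))) (≡.sym (punchIn-punchIn j k y)))))) ⟩
      G j k + sgn j′ * M (suc zero) j′ * (sgn k′ * M zero j * d j k)
        ≈⟨ solve 7 (λ a b e f u v w → a :* u :* (b :* v :* w) :+ e :* v :* (f :* u :* w)
                                       := (a :* b :+ e :* f) :* (u :* v :* w))
             refl (sgn j) (sgn k) (sgn j′) (sgn k′) (M zero j) (M (suc zero) j′) (d j k) ⟩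
      (sgn j * sgn k + sgn j′ * sgn k′) * (M zero j * M (suc zero) j′ * d j k)
        ≈⟨ *-congʳ (sgn-other j k) ⟩
      0# * (M zero j * M (suc zero) j′ * d j k) ≈⟨ zeroˡ _ ⟩
      0# ∎
      where
      j′ = punchIn j k
      k′ = other j k

  -- Vanishing rather than a change of sign: over a general ring `d ≈ - d` does not give `d ≈ 0#`.
  AlternatesAt : ∀ {n} → Fin n → Fin n → Set (c ⊔ ℓ)
  AlternatesAt {n} x y = ∀ (M : Matrix n) → (∀ j → M x j ≈ M y j) → det M ≈ 0#

  -- Polarisation: putting r + s in both rows gives zero, and of the four terms of the bilinear
  -- expansion the two diagonal ones vanish as well.
  det-swap′ : ∀ {n} {x y : Fin n} → x ≢ y → AlternatesAt x y → ∀ (M : Matrix n) r s →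
              det (M [ x ≔ r ] [ y ≔ s ]) + det (M [ x ≔ s ] [ y ≔ r ]) ≈ 0#
  det-swap′ {n} {x} {y} x≢y alt M r s = begin
    φ r s + φ s r                       ≈⟨ +-cong (+-identityˡ _) (+-identityʳ _) ⟨
    (0# + φ r s) + (φ s r + 0#)         ≈⟨ +-cong (+-congʳ (φ-diag r)) (+-congˡ (φ-diag s)) ⟨
    (φ r r + φ r s) + (φ s r + φ s s)   ≈⟨ +-cong (φ-+ʳ r r s) (φ-+ʳ s r s) ⟨
    φ r (r ⊞ s) + φ s (r ⊞ s)           ≈⟨ φ-+ˡ (r ⊞ s) r s ⟨
    φ (r ⊞ s) (r ⊞ s)                   ≈⟨ φ-diag (r ⊞ s) ⟩
    0#                                  ∎
    where
    φ : Vector Carrier n → Vector Carrier n → Carrier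
    φ r s = det (M [ x ≔ r ] [ y ≔ s ])

    _⊞_ : Vector Carrier n → Vector Carrier n → Vector Carrier n
    (r ⊞ s) j = r j + s j

    φ-diag : ∀ r → φ r r ≈ 0#
    φ-diag r = alt _ λ j → ≡⇒≋ (≡.trans
      (≡.trans (updateAt-minimal x y _ x≢y) (updateAt-updates x M))
      (≡.sym (updateAt-updates y (M [ x ≔ r ])))) j

    φ-+ʳ : ∀ q r s → φ q (r ⊞ s) ≈ φ q r + φ q s
    φ-+ʳ q r s = IsLinear.+-homo (det-isLinear (M [ x ≔ q ]) y) r s

    comm : ∀ q r → φ q r ≈ det (M [ y ≔ r ] [ x ≔ q ])
    comm q r = det-cong λ i j → ≡⇒≋ (updateAt-commutes y x (x≢y ∘ ≡.sym) M i) j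

    φ-+ˡ : ∀ q r s → φ (r ⊞ s) q ≈ φ r q + φ s q
    φ-+ˡ q r s = trans (comm _ _)
      (trans (IsLinear.+-homo (det-isLinear (M [ y ≔ q ]) x) r s) (sym (+-cong (comm r q) (comm s q))))

  updateAt-≈ : ∀ {n} (M : Matrix n) {x r} → (∀ j → M x j ≈ r j) → M ≈ᴹ M [ x ≔ r ]
  updateAt-≈ M {x} {r} Mx≈r = updateAt-elim M x r (λ i s → ∀ j → M i j ≈ s j) Mx≈r (λ _ _ _ → refl)

  mutual
    det-alternating : ∀ {n} {x y : Fin n} → x ≢ y → AlternatesAt x y
    det-alternating {x = zero}  {zero}        0≢0 = contradiction ≡.refl 0≢0
    det-alternating {x = zero}  {suc y}       _   = det-rows₀ y
    det-alternating {x = suc x} {zero}        _   = λ M Mx≈My → det-rows₀ x M λ j → sym (Mx≈My j)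
    det-alternating {x = suc x} {suc y}       x≢y = det-minor-alternating (x≢y ∘ ≡.cong suc)

    det-minor-alternating : ∀ {n} {x y : Fin n} → x ≢ y → AlternatesAt (suc x) (suc y)
    det-minor-alternating x≢y M Mx≈My = sum-zero λ j →
      trans (*-congˡ {sgn j * M zero j} (det-alternating x≢y (minor₀ M j) λ k → Mx≈My (punchIn j k)))
            (zeroʳ _)

    -- The expansion runs along row zero, so a coincidence with that row is not inherited by the
    -- minors. Two lower rows do alternate, by recursion on the size, and swapping them moves the
    -- coincidence into rows zero and one.
    det-rows₀ : ∀ {n} (y : Fin n) → AlternatesAt zero (suc y)
    det-rows₀ zero    M M₀≈M₁ = det-rows₀₁ M M₀≈M₁
    det-rows₀ (suc y) M M₀≈My = begin
      det M
        ≈⟨ det-cong (λ i j → trans (updateAt-≈ M {suc zero} (λ _ → refl) i j)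
             (updateAt-≈ (M [ suc zero ≔ M (suc zero) ]) {suc (suc y)} (λ j → sym (M₀≈My j)) i j)) ⟩
      det (M [ suc zero ≔ M (suc zero) ] [ suc (suc y) ≔ M zero ])
        ≈⟨ +-identityʳ _ ⟨
      det (M [ suc zero ≔ M (suc zero) ] [ suc (suc y) ≔ M zero ]) + 0#
        -- The added zero is the determinant of the swapped matrix, whose rows zero and one are both
        -- `M zero`; the sum then has the form of `det-swap′`.
        ≈⟨ +-congˡ (det-rows₀₁ (M [ suc zero ≔ M zero ] [ suc (suc y) ≔ M (suc zero) ]) (λ _ → refl)) ⟨
      det (M [ suc zero ≔ M (suc zero) ] [ suc (suc y) ≔ M zero ]) +
      det (M [ suc zero ≔ M zero ] [ suc (suc y) ≔ M (suc zero) ])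
        ≈⟨ det-swap′ {x = suc zero} {suc (suc y)} (λ ()) (det-minor-alternating λ ())
             M (M (suc zero)) (M zero) ⟩
      0# ∎

  det-swap : ∀ {n} {x y : Fin n} → x ≢ y → ∀ (M : Matrix n) r s →
             det (M [ x ≔ r ] [ y ≔ s ]) ≈ - det (M [ x ≔ s ] [ y ≔ r ])
  det-swap x≢y M r s = inverseˡ-unique _ _ (det-swap′ x≢y (det-alternating x≢y) M r s)

-- Subsets obtained by deleting one missing point at a time.

-- Supports recursion on the ambient size: a missing point is a unit row that can be expanded away,
-- and when no point is missing the principal submatrix is the whole matrix up to `cast`.
data OutsideView : ∀ {n} → Subset n → Set where
  full : ∀ {n} → OutsideView (⊤ {n})
  del  : ∀ {n} (α : Subset n) x → OutsideView (insertAt α x outside)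

outsideView : ∀ {n} (α : Subset n) → OutsideView α
outsideView []            = full
outsideView (outside ∷ α) = del α zero
outsideView (inside  ∷ α) with outsideView α
... | full    = full
... | del β x = del (inside ∷ β) (suc x)

element-⊤ : ∀ {n} .(eq : ∣ ⊤ {n} ∣ ≡ n) i → element ⊤ i ≡ cast eq i
element-⊤ {suc n} eq zero    = ≡.refl
element-⊤ {suc n} eq (suc i) = ≡.cong suc (element-⊤ (ℕ.suc-injective eq) i)

∣insertAt-outside∣ : ∀ {n} (α : Subset n) x → ∣ insertAt α x outside ∣ ≡ ∣ α ∣
∣insertAt-outside∣ α             zero    = ≡.refl
∣insertAt-outside∣ (inside  ∷ α) (suc x) = ≡.cong suc (∣insertAt-outside∣ α x)
∣insertAt-outside∣ (outside ∷ α) (suc x) = ∣insertAt-outside∣ α x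

element-insertAt-outside : ∀ {n} (α : Subset n) x .(eq : ∣ insertAt α x outside ∣ ≡ ∣ α ∣) i →
                           element (insertAt α x outside) i ≡ punchIn x (element α (cast eq i))
element-insertAt-outside α zero eq i =
  ≡.cong (suc ∘ element α) (≡.sym (Fin.cast-is-id eq i))
element-insertAt-outside (inside  ∷ α) (suc x) eq zero    = ≡.refl
element-insertAt-outside (inside  ∷ α) (suc x) eq (suc i) =
  ≡.cong suc (element-insertAt-outside α x (ℕ.suc-injective eq) i)
element-insertAt-outside (outside ∷ α) (suc x) eq i = ≡.cong suc (element-insertAt-outside α x eq i)

element-injective : ∀ {n} (α : Subset n) {i j} → element α i ≡ element α j → i ≡ j
element-injective (inside  ∷ α) {zero}  {zero}  _  = ≡.refl
element-injective (inside  ∷ α) {suc i} {suc j} eq = ≡.cong suc (element-injective α (Fin.suc-injective eq))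
element-injective (outside ∷ α)                 eq = element-injective α (Fin.suc-injective eq)

_∈×∈?_ : ∀ {n} ((x , y) : Fin n × Fin n) (α : Subset n) → Dec (x ∈ α × y ∈ α)
(x , y) ∈×∈? α = x ∈? α ×-dec y ∈? α

choose : ∀ {a} {A : Set a} {n} → Subset n → Vector A n → Vector A n → Vector A n
choose α X Y i = if lookup α i then Y i else X i

-- Expanding the determinant of a sum into principal minors.

module Expansion {c ℓ} (K : CommutativeRing c ℓ) where
  open CommutativeRing K hiding (zero)
  open Scalars K using (Matrix; _≈ᴹ_; I; det; _[_])
  open Determinant K
  open SemiringSum semiring
    using (sum; sum-cong-≋; *-distribˡ-sum)
  open RingProperties ring using (-1*x≈-x; -‿distribˡ-*; -‿distribʳ-*; -‿involutive)
  open SetoidReasoning setoid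
  open RingSolver commutativeSemiring using (solve; _:=_; _:*_)

  I-diag : ∀ {n} (x : Fin n) → I x x ≈ 1#
  I-diag x with x Fin.≟ x
  ... | yes _  = refl
  ... | no x≢x = contradiction ≡.refl x≢x

  I-off : ∀ {n} {x y : Fin n} → x ≢ y → I x y ≈ 0#
  I-off {x = x} {y} x≢y with x Fin.≟ y
  ... | yes x≡y = contradiction x≡y x≢y
  ... | no _    = refl

  I-∘ : ∀ {m n} (f : Fin m → Fin n) → (∀ {x y} → f x ≡ f y → x ≡ y) → ∀ x y → I (f x) (f y) ≈ I x y
  I-∘ f inj x y with x Fin.≟ y
  ... | yes ≡.refl = I-diag (f x)
  ... | no x≢y     = I-off (x≢y ∘ inj)

  sgn*sgn : ∀ {n} (x : Fin n) → sgn x * sgn x ≈ 1#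
  sgn*sgn zero    = *-identityˡ 1#
  sgn*sgn (suc x) = begin
    - 1# * sgn x * (- 1# * sgn x) ≈⟨ *-cong (-1*x≈-x _) (-1*x≈-x _) ⟩
    - sgn x * - sgn x             ≈⟨ -‿distribˡ-* _ _ ⟨
    - (sgn x * - sgn x)           ≈⟨ -‿cong (sym (-‿distribʳ-* _ _)) ⟩
    - - (sgn x * sgn x)           ≈⟨ -‿involutive _ ⟩
    sgn x * sgn x                 ≈⟨ sgn*sgn x ⟩
    1#                            ∎

  front : ∀ {n} → Fin (suc n) → Matrix (suc n) → Matrix (suc n)
  front x M zero    = M x
  front x M (suc i) = M (punchIn x i)

  -- Bringing row x to the top costs the same sign as the Laplace coefficient of
  -- column x, so the sign is absent from det-unitRow.
  det-front : ∀ {n} (M : Matrix (suc n)) x → det M ≈ sgn x * det (front x M)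
  det-front M zero = trans (det-cong {M = M} {front zero M} λ { zero _ → refl ; (suc _) _ → refl })
                           (sym (*-identityˡ _))
  det-front {suc n} M (suc x) = begin
    det M
      ≈⟨ (sum-cong-≋ λ j → trans (*-congˡ {sgn j * M zero j} (det-front (minor₀ M j) x))
           (solve 3 (λ a b d → a :* (b :* d) := b :* (a :* d)) refl
                    (sgn j * M zero j) (sgn x) (det (front x (minor₀ M j))))) ⟩
    sum (λ j → sgn x * (sgn j * M zero j * det (front x (minor₀ M j))))
      ≈⟨ *-distribˡ-sum (sgn x) (λ j → sgn j * M zero j * det (front x (minor₀ M j))) ⟨
    sgn x * sum (λ j → sgn j * M zero j * det (front x (minor₀ M j)))
      ≈⟨ *-congˡ (sum-cong-≋ λ j → *-congˡ {sgn j * M zero j}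
           (det-cong {M = front x (minor₀ M j)} {minor₀ M′ j} λ { zero _ → refl ; (suc _) _ → refl })) ⟩
    sgn x * det M′
      ≈⟨ *-congˡ (det-swap {x = zero} {suc zero} (λ ()) N (N (suc zero)) (N zero)) ⟩
    sgn x * - det (N [ zero ≔ N zero ] [ suc zero ≔ N (suc zero) ])
      ≈⟨ *-congˡ (-‿cong (det-cong {M = N [ zero ≔ N zero ] [ suc zero ≔ N (suc zero) ]} {N}
           λ { zero _ → refl ; (suc zero) _ → refl ; (suc (suc _)) _ → refl })) ⟩
    sgn x * - det N     ≈⟨ -‿distribʳ-* _ _ ⟨
    - (sgn x * det N)   ≈⟨ -‿distribˡ-* _ _ ⟩
    - sgn x * det N     ≈⟨ *-congʳ (-1*x≈-x _) ⟨
    - 1# * sgn x * det N ∎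
    where
    N : Matrix (suc (suc n))
    N = front (suc x) M

    M′ : Matrix (suc (suc n))
    M′ = N [ zero ≔ N (suc zero) ] [ suc zero ≔ N zero ]

  minor : ∀ {n} → Matrix (suc n) → Fin (suc n) → Matrix n
  minor M x i j = M (punchIn x i) (punchIn x j)

  det-unitRow : ∀ {n} (M : Matrix (suc n)) x → (∀ j → M x j ≈ I x j) → det M ≈ det (minor M x)
  det-unitRow M x Mx≈Ix = begin
    det M                   ≈⟨ det-front M x ⟩
    sgn x * det (front x M) ≈⟨ *-congˡ (sum-only x λ j j≢x → begin
      sgn j * M x j * det (minor₀ (front x M) j) 
        ≈⟨ *-congʳ (*-congˡ (trans (Mx≈Ix j) (I-off (j≢x ∘ ≡.sym)))) ⟩
      sgn j * 0# * det (minor₀ (front x M) j)    ≈⟨ *-congʳ (zeroʳ _) ⟩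
      0# * det (minor₀ (front x M) j)            ≈⟨ zeroˡ _ ⟩
      0#                                         ∎) ⟩
    sgn x * (sgn x * M x x * det (minor M x))
      ≈⟨ *-congˡ (*-congʳ (trans (*-congˡ (trans (Mx≈Ix x) (I-diag x))) (*-identityʳ _))) ⟩
    sgn x * (sgn x * det (minor M x))         ≈⟨ *-assoc _ _ _ ⟨
    sgn x * sgn x * det (minor M x)           ≈⟨ *-congʳ (sgn*sgn x) ⟩
    1# * det (minor M x)                      ≈⟨ *-identityˡ _ ⟩
    det (minor M x)                           ∎

  det-I : ∀ {n} → det (I {n}) ≈ 1#
  det-I {zero}  = refl
  det-I {suc n} = trans (det-unitRow (I {suc n}) zero λ _ → refl)
    (trans (det-cong {M = minor (I {suc n}) zero} {I} (I-∘ suc Fin.suc-injective)) (det-I {n}))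

  det-zeroRow : ∀ {n} (M : Matrix n) x → (∀ j → M x j ≈ 0#) → det M ≈ 0#
  det-zeroRow M x Mx≈0 = trans (det-cong (updateAt-≈ M Mx≈0)) (IsLinear.0-homo (det-isLinear M x))

  det-reindex : ∀ {m n} (eq : m ≡ n) {M : Matrix m} {N : Matrix n} →
                (∀ i j → M i j ≈ N (cast eq i) (cast eq j)) → det M ≈ det N
  det-reindex ≡.refl {M} {N} M≈N = det-cong λ i j → trans (M≈N i j)
    (reflexive (≡.cong₂ N (Fin.cast-is-id ≡.refl i) (Fin.cast-is-id ≡.refl j)))

  -- Every row outside α is a row of the identity, so expanding along it deletes that row and the
  -- matching column without a sign. Repeating this leaves exactly the rows and columns in α.
  det-choose : ∀ {n} (α : Subset n) (N : Matrix n) → det (choose α I N) ≈ det (N [ α ])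
  det-choose {n} α N with outsideView α
  ... | full = trans
    (det-cong λ i j → reflexive (≡.cong (λ b → (if b then N i else I i) j) (lookup-replicate i inside)))
    (sym (det-reindex (∣⊤∣≡n n) λ i j →
      reflexive (≡.cong₂ N (element-⊤ (∣⊤∣≡n n) i) (element-⊤ (∣⊤∣≡n n) j))))
  det-choose {suc n} _ N | del α x = begin
    det (choose α+x I N)
      ≈⟨ det-unitRow (choose α+x I N) x (λ j →
           reflexive (≡.cong (λ b → (if b then N x else I x) j) (insertAt-lookup α x outside))) ⟩
    det (minor (choose α+x I N) x)
      ≈⟨ det-cong minor-choose ⟩
    det (choose α I (minor N x))
      ≈⟨ det-choose α (minor N x) ⟩
    det (minor N x [ α ])
      ≈⟨ det-reindex eq (λ i j →
           reflexive (≡.cong₂ N (element-insertAt-outside α x eq i) (element-insertAt-outside α x eq j))) ⟨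
    det (N [ α+x ]) ∎
    where
    α+x = insertAt α x outside
    eq = ∣insertAt-outside∣ α x

    minor-choose : minor (choose α+x I N) x ≈ᴹ choose α I (minor N x)
    minor-choose i j rewrite insertAt-punchIn α x outside i with lookup α i
    ... | true  = refl
    ... | false = I-∘ (punchIn x) (Fin.punchIn-injective x _ _) i j

  -- The recursion follows the row-by-row expansion; `inside` comes before `outside`, in the order
  -- of the list `subsets`.
  ∑ₛ : ∀ {n} → (Subset n → Carrier) → Carrier
  ∑ₛ {zero}  f = f []
  ∑ₛ {suc n} f = ∑ₛ (f ∘ (inside ∷_)) + ∑ₛ (f ∘ (outside ∷_))

  ∑ₛ-cong : ∀ {n} {f g : Subset n → Carrier} → (∀ α → f α ≈ g α) → ∑ₛ f ≈ ∑ₛ g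
  ∑ₛ-cong {zero}  f≈g = f≈g []
  ∑ₛ-cong {suc n} f≈g = +-cong (∑ₛ-cong (f≈g ∘ (inside ∷_))) (∑ₛ-cong (f≈g ∘ (outside ∷_)))

  -- The number n of rows is independent of their length m, because `expand` freezes the first row
  -- and continues with a function of the remaining ones.
  record IsMultiadditive {m n} (f : (Fin n → Vector Carrier m) → Carrier) : Set (c ⊔ ℓ) where
    field
      cong   : ∀ {X Y} → (∀ i j → X i j ≈ Y i j) → f X ≈ f Y
      +-homo : ∀ X i r s → f (X [ i ≔ (λ j → r j + s j) ]) ≈ f (X [ i ≔ r ]) + f (X [ i ≔ s ])

  expand : ∀ {m n} {f : (Fin n → Vector Carrier m) → Carrier} → IsMultiadditive f → ∀ X Y →
           f (λ i j → X i j + Y i j) ≈ ∑ₛ (λ α → f (choose α X Y))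
  expand {n = zero}      mul X Y = IsMultiadditive.cong mul λ ()
  expand {m} {suc n} {f} mul X Y = begin
    f Z                                   ≈⟨ cong (λ { zero _ → refl ; (suc _) _ → refl }) ⟩
    f (Z [ zero ≔ (λ j → X zero j + Y zero j) ]) ≈⟨ +-homo Z zero (X zero) (Y zero) ⟩
    f (Z [ zero ≔ X zero ]) + f (Z [ zero ≔ Y zero ]) ≈⟨ +-comm _ _ ⟩
    f (Z [ zero ≔ Y zero ]) + f (Z [ zero ≔ X zero ]) ≈⟨ +-cong (ih (Y zero)) (ih (X zero)) ⟩
    ∑ₛ (λ α → f (Y zero ∷ᶠ choose α (X ∘ suc) (Y ∘ suc))) +
    ∑ₛ (λ α → f (X zero ∷ᶠ choose α (X ∘ suc) (Y ∘ suc)))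
      ≈⟨ +-cong (∑ₛ-cong λ α → cong {Y zero ∷ᶠ choose α (X ∘ suc) (Y ∘ suc)} {choose (inside ∷ α) X Y}
                           λ { zero _ → refl ; (suc _) _ → refl })
                (∑ₛ-cong λ α → cong {X zero ∷ᶠ choose α (X ∘ suc) (Y ∘ suc)} {choose (outside ∷ α) X Y}
                           λ { zero _ → refl ; (suc _) _ → refl }) ⟩
    ∑ₛ (λ α → f (choose α X Y)) ∎
    where
    open IsMultiadditive mul

    Z : Fin (suc n) → Vector Carrier m
    Z i j = X i j + Y i j

    ih : ∀ r → f (Z [ zero ≔ r ]) ≈ ∑ₛ (λ α → f (r ∷ᶠ choose α (X ∘ suc) (Y ∘ suc)))
    ih r = trans (cong λ { zero _ → refl ; (suc _) _ → refl }) (expand {f = λ W → f (r ∷ᶠ W)} (record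
      { cong   = λ X≈Y → cong λ { zero _ → refl ; (suc i) → X≈Y i }
      ; +-homo = λ X i s t → trans (cong λ { zero _ → refl ; (suc i) _ → refl })
          (trans (+-homo (r ∷ᶠ X) (suc i) s t)
            (+-cong (cong λ { zero _ → refl ; (suc i) _ → refl })
                    (cong λ { zero _ → refl ; (suc i) _ → refl })))
      }) (X ∘ suc) (Y ∘ suc))

  det-isMultiadditive : ∀ {n} → IsMultiadditive (det {n})
  det-isMultiadditive = record
    { cong = det-cong ; +-homo = λ X i → IsLinear.+-homo (det-isLinear X i) }

  -- A term α takes the rows outside α from the truncated identity. If α misses x or y, one of these
  -- rows is zero; otherwise the truncation is invisible and `det-choose` applies. The case x = y is
  -- included.
  det-I+ : ∀ {n} (x y : Fin n) (N : Matrix n) →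
           det (λ i j → (I [ x ≔ const 0# ] [ y ≔ const 0# ]) i j + N i j) ≈
           ∑ₛ (λ α → if does ((x , y) ∈×∈? α) then det (N [ α ]) else 0#)
  det-I+ {n} x y N = trans (expand det-isMultiadditive I₀ N) (∑ₛ-cong term)
    where
    I₀ : Matrix n
    I₀ = I [ x ≔ const 0# ] [ y ≔ const 0# ]

    term : ∀ α → det (choose α I₀ N) ≈ (if does ((x , y) ∈×∈? α) then det (N [ α ]) else 0#)
    term α with x ∈? α | y ∈? α
    ... | yes x∈α | yes y∈α = trans (det-cong same) (det-choose α N)
      where
      same : choose α I₀ N ≈ᴹ choose α I N
      same i j with lookup α i in eq
      ... | true  = refl
      ... | false = ≡⇒≋ (≡.trans
        (updateAt-minimal i y (I [ x ≔ const 0# ]) λ { ≡.refl →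
          contradiction (≡.trans (≡.sym ([]=⇒lookup y∈α)) eq) λ () })
        (updateAt-minimal i x I λ { ≡.refl →
          contradiction (≡.trans (≡.sym ([]=⇒lookup x∈α)) eq) λ () })) j
    ... | no x∉α | _ = det-zeroRow _ x zeroRow
      where
      zeroRow : ∀ j → choose α I₀ N x j ≈ 0#
      zeroRow j with lookup α x in eq
      ... | true  = contradiction (lookup⇒[]= x α eq) x∉α
      -- Since x may equal y, row x was zeroed either by the outer or by the inner replacement; the
      -- motive with `i ≡ x` covers both.
      ... | false = updateAt-elim (I [ x ≔ const 0# ]) y (const 0#) (λ i r → i ≡ x → r j ≈ 0#)
        (λ _ → refl) (λ i _ i≡x → ≡⇒≋ (≡.trans (≡.cong (I [ x ≔ const 0# ]) i≡x) (updateAt-updates x I)) j)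
        x ≡.refl
    ... | yes _ | no y∉α = det-zeroRow _ y zeroRow
      where
      zeroRow : ∀ j → choose α I₀ N y j ≈ 0#
      zeroRow j with lookup α y in eq
      ... | true  = contradiction (lookup⇒[]= y α eq) y∉α
      ... | false = ≡⇒≋ (updateAt-updates y (I [ x ≔ const 0# ])) j

-- Division-free Cramer rules for one and two replaced rows.

module Cramer {c ℓ} (K : CommutativeRing c ℓ) where
  open CommutativeRing K hiding (zero)
  open Scalars K using (Matrix; _≈ᴹ_; det)
  open Determinant K
  open SemiringSum semiring using (sum)
  open RingProperties ring using (-‿distribʳ-*; -‿distribˡ-*)
  open SetoidReasoning setoid
  open RingSolver commutativeSemiring using (solve; _:=_; _:+_; _:*_)

  sum-only₂ : ∀ {n} {f : Vector Carrier n} {x y} → x ≢ y → (∀ i → i ≢ x → i ≢ y → f i ≈ 0#) →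
              sum f ≈ f x + f y
  sum-only₂ {x = zero}  {zero}  0≢0 h = contradiction ≡.refl 0≢0
  sum-only₂ {x = zero}  {suc y} x≢y h =
    +-congˡ (sum-only y λ i i≢y → h (suc i) (λ ()) (i≢y ∘ Fin.suc-injective))
  sum-only₂ {x = suc x} {zero}  x≢y h =
    trans (+-congˡ (sum-only x λ i i≢x → h (suc i) (i≢x ∘ Fin.suc-injective) (λ ()))) (+-comm _ _)
  sum-only₂ {x = suc x} {suc y} x≢y h =
    trans (+-cong (h zero (λ ()) (λ ())) (sum-only₂ (x≢y ∘ ≡.cong suc)
            λ i i≢x i≢y → h (suc i) (i≢x ∘ Fin.suc-injective) (i≢y ∘ Fin.suc-injective)))
          (+-identityˡ _)

  _∈Row_by_ : ∀ {n} → Vector Carrier n → Matrix n → Vector Carrier n → Set ℓ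
  r ∈Row B by h = ∀ j → r j ≈ sum (λ z → h z * B z j)

  det-repeat : ∀ {n} (M : Matrix n) {x z} {r : Vector Carrier n} → z ≢ x → (∀ j → M z j ≈ r j) →
               det (M [ x ≔ r ]) ≈ 0#
  det-repeat M {x} {z} {r} z≢x Mz≈r = det-alternating z≢x (M [ x ≔ r ]) λ j →
    trans (≡⇒≋ (updateAt-minimal z x M z≢x) j)
          (trans (Mz≈r j) (≡⇒≋ (≡.sym (updateAt-updates x M)) j))

  -- By linearity in row x, every summand with z ≠ x repeats row z of B and vanishes. No inverse of
  -- B or of its determinant enters.
  cramer : ∀ {n} (B : Matrix n) {r h} → r ∈Row B by h → ∀ x → det (B [ x ≔ r ]) ≈ h x * det B
  cramer B {r} {h} r≈hB x = begin
    det (B [ x ≔ r ])                        ≈⟨ cong r≈hB ⟩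
    det (B [ x ≔ (λ j → sum λ z → h z * B z j) ]) ≈⟨ sum-homo h B ⟩
    sum (λ z → h z * det (B [ x ≔ B z ]))
      ≈⟨ sum-only x (λ z z≢x → trans (*-congˡ (det-repeat B z≢x λ _ → refl)) (zeroʳ _)) ⟩
    h x * det (B [ x ≔ B x ])                ≈⟨ *-congˡ (det-cong (updateAt-≈ B λ _ → refl)) ⟨
    h x * det B                              ∎
    where open IsLinear (det-isLinear B x)

  -- Only s is expanded by hand. The summands that survive put row x or row y of B in place y: the
  -- latter undoes the second replacement and leaves `h x`, while the former needs a swap, whence
  -- the sign and `h y`. The factor is the 2 by 2 minor of the coefficients.
  cramer₂ : ∀ {n} (B : Matrix n) {r h s g} → r ∈Row B by h → s ∈Row B by g → ∀ {x y} → x ≢ y →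
            det (B [ x ≔ r ] [ y ≔ s ]) ≈ (h x * g y + - (h y * g x)) * det B
  cramer₂ B {r} {h} {s} {g} r≈hB s≈gB {x} {y} x≢y = begin
    det (C [ y ≔ s ])                                   ≈⟨ cong s≈gB ⟩
    det (C [ y ≔ (λ j → sum λ z → g z * B z j) ])       ≈⟨ sum-homo g B ⟩
    sum (λ z → g z * det (C [ y ≔ B z ]))
      ≈⟨ sum-only₂ x≢y (λ z z≢x z≢y → trans (*-congˡ
           (det-repeat C z≢y λ j → ≡⇒≋ (updateAt-minimal z x B z≢x) j)) (zeroʳ _)) ⟩
    g x * det (C [ y ≔ B x ]) + g y * det (C [ y ≔ B y ])
      ≈⟨ +-cong (*-congˡ swapped) (*-congˡ unchanged) ⟩
    g x * - (h y * det B) + g y * (h x * det B)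
      ≈⟨ +-congʳ (trans (sym (-‿distribʳ-* _ _)) (trans
           (-‿cong (solve 3 (λ a b d → a :* (b :* d) := b :* a :* d) refl (g x) (h y) (det B)))
           (-‿distribˡ-* _ _))) ⟩
    - (h y * g x) * det B + g y * (h x * det B)
      ≈⟨ solve 4 (λ m a b d → m :* d :+ a :* (b :* d) := (b :* a :+ m) :* d) refl
           (- (h y * g x)) (g y) (h x) (det B) ⟩
    (h x * g y + - (h y * g x)) * det B ∎
    where
    C : Matrix _
    C = B [ x ≔ r ]

    open IsLinear (det-isLinear C y)

    swapped : det (C [ y ≔ B x ]) ≈ - (h y * det B)
    swapped = begin
      det (B [ x ≔ r ] [ y ≔ B x ])   ≈⟨ det-swap x≢y B r (B x) ⟩
      - det (B [ x ≔ B x ] [ y ≔ r ]) ≈⟨ -‿cong (cramer′ (B [ x ≔ B x ]) (updateAt-≈ B λ _ → refl)) ⟩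
      - (h y * det B)                 ∎
      where
      cramer′ : ∀ B′ → B ≈ᴹ B′ → det (B′ [ y ≔ r ]) ≈ h y * det B
      cramer′ B′ B≈B′ = trans (det-cong (updateAt-elim B′ y r
          (λ i q → ∀ j → q j ≈ (B [ y ≔ r ]) i j)
          (λ j → ≡⇒≋ (≡.sym (updateAt-updates y B)) j)
          (λ i i≢y j → trans (sym (B≈B′ i j)) (≡⇒≋ (≡.sym (updateAt-minimal i y B i≢y)) j))))
        (cramer B r≈hB y)

    unchanged : det (C [ y ≔ B y ]) ≈ h x * det B
    unchanged = trans
      (sym (det-cong (updateAt-≈ C λ j → ≡⇒≋ (updateAt-minimal y x B (x≢y ∘ ≡.sym)) j)))
      (cramer B r≈hB x)

-- The ring of formal power series.

module PowerSeries {c ℓ} (K : CommutativeRing c ℓ) where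
  open CommutativeRing K hiding (zero)
  open SetoidReasoning setoid
  open RingSolver commutativeSemiring using (solve; _:=_; _:+_; _:*_)

  Series : Set c
  Series = ℕ → Carrier

  infixl 7 _⊛_
  _⊛_ : Series → Series → Series
  (p ⊛ q) zero    = p 0 * q 0
  (p ⊛ q) (suc n) = p 0 * q (suc n) + ((p ∘ suc) ⊛ q) n

  ⊛-cong : ∀ {p p′ q q′} → (∀ n → p n ≈ p′ n) → (∀ n → q n ≈ q′ n) → ∀ n → (p ⊛ q) n ≈ (p′ ⊛ q′) n
  ⊛-cong p≈ q≈ zero    = *-cong (p≈ 0) (q≈ 0)
  ⊛-cong p≈ q≈ (suc n) = +-cong (*-cong (p≈ 0) (q≈ (suc n))) (⊛-cong (p≈ ∘ suc) q≈ n)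

  ⊛-zeroˡ : ∀ q n → ((λ _ → 0#) ⊛ q) n ≈ 0#
  ⊛-zeroˡ q zero    = zeroˡ _
  ⊛-zeroˡ q (suc n) = trans (+-cong (zeroˡ _) (⊛-zeroˡ q n)) (+-identityʳ 0#)

  ⊛-scaleˡ : ∀ a p q n → ((λ i → a * p i) ⊛ q) n ≈ a * (p ⊛ q) n
  ⊛-scaleˡ a p q zero    = *-assoc _ _ _
  ⊛-scaleˡ a p q (suc n) = trans (+-cong (*-assoc _ _ _) (⊛-scaleˡ a (p ∘ suc) q n)) (sym (distribˡ _ _ _))

  ⊛-distribʳ : ∀ q p p′ n → ((λ i → p i + p′ i) ⊛ q) n ≈ (p ⊛ q) n + (p′ ⊛ q) n
  ⊛-distribʳ q p p′ zero    = distribʳ _ _ _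
  ⊛-distribʳ q p p′ (suc n) = trans (+-congˡ (⊛-distribʳ q (p ∘ suc) (p′ ∘ suc) n))
    (solve 5 (λ a b q x y → (a :+ b) :* q :+ (x :+ y) := a :* q :+ x :+ (b :* q :+ y)) refl
       (p 0) (p′ 0) (q (suc n)) _ _)

  -- The product is defined by peeling the constant term of the left factor. This mirror recursion
  -- peels the right factor, and commutativity follows by comparing the two.
  ⊛-sucʳ : ∀ p q n → (p ⊛ q) (suc n) ≈ q 0 * p (suc n) + (p ⊛ (q ∘ suc)) n
  ⊛-sucʳ p q zero    =
    solve 4 (λ a b x y → a :* b :+ x :* y := y :* x :+ a :* b) refl (p 0) (q 1) (p 1) (q 0)
  ⊛-sucʳ p q (suc n) = trans (+-congˡ (⊛-sucʳ (p ∘ suc) q n))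
    (solve 3 (λ a b x → a :+ (b :+ x) := b :+ (a :+ x)) refl _ _ _)

  ⊛-comm : ∀ p q n → (p ⊛ q) n ≈ (q ⊛ p) n
  ⊛-comm p q zero    = *-comm _ _
  ⊛-comm p q (suc n) = trans (+-congˡ (⊛-comm (p ∘ suc) q n)) (sym (⊛-sucʳ q p n))

  ⊛-assoc : ∀ p q r n → ((p ⊛ q) ⊛ r) n ≈ (p ⊛ (q ⊛ r)) n
  ⊛-assoc p q r zero    = *-assoc _ _ _
  ⊛-assoc p q r (suc n) = begin
    p 0 * q 0 * r (suc n) + ((λ i → p 0 * q (suc i) + ((p ∘ suc) ⊛ q) i) ⊛ r) n
      ≈⟨ +-congˡ (⊛-distribʳ r (λ i → p 0 * q (suc i)) ((p ∘ suc) ⊛ q) n) ⟩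
    p 0 * q 0 * r (suc n) + (((λ i → p 0 * q (suc i)) ⊛ r) n + (((p ∘ suc) ⊛ q) ⊛ r) n)
      ≈⟨ +-congˡ (+-cong (⊛-scaleˡ (p 0) (q ∘ suc) r n) (⊛-assoc (p ∘ suc) q r n)) ⟩
    p 0 * q 0 * r (suc n) + (p 0 * ((q ∘ suc) ⊛ r) n + ((p ∘ suc) ⊛ (q ⊛ r)) n)
      ≈⟨ solve 5 (λ a b e x y → a :* b :* e :+ (a :* x :+ y) := a :* (b :* e :+ x) :+ y) refl
           (p 0) (q 0) (r (suc n)) (((q ∘ suc) ⊛ r) n) (((p ∘ suc) ⊛ (q ⊛ r)) n) ⟩
    p 0 * (q 0 * r (suc n) + ((q ∘ suc) ⊛ r) n) + ((p ∘ suc) ⊛ (q ⊛ r)) n ∎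

  constant : Carrier → Series
  constant a zero    = a
  constant a (suc n) = 0#

  shift : Series → Series
  shift p zero    = 0#
  shift p (suc n) = p n

  monomial : ℕ → Carrier → Series
  monomial zero    a = constant a
  monomial (suc n) a = shift (monomial n a)

  constant-⊛ : ∀ a q n → (constant a ⊛ q) n ≈ a * q n
  constant-⊛ a q zero    = refl
  constant-⊛ a q (suc n) = trans (+-congˡ (⊛-zeroˡ q n)) (+-identityʳ _)

  shift-⊛ : ∀ p q n → (shift p ⊛ q) n ≈ shift (p ⊛ q) n
  shift-⊛ p q zero    = zeroˡ _
  shift-⊛ p q (suc n) = trans (+-congʳ (zeroˡ _)) (+-identityˡ _)

  shift-cong : ∀ {p q} → (∀ n → p n ≈ q n) → ∀ n → shift p n ≈ shift q n
  shift-cong p≈q zero    = refl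
  shift-cong p≈q (suc n) = p≈q n

  monomial-cong : ∀ k {a b} → a ≈ b → ∀ n → monomial k a n ≈ monomial k b n
  monomial-cong zero    a≈b zero    = a≈b
  monomial-cong zero    a≈b (suc n) = refl
  monomial-cong (suc k) a≈b         = shift-cong (monomial-cong k a≈b)

  monomial-* : ∀ k a b n → a * monomial k b n ≈ monomial k (a * b) n
  monomial-* zero    a b zero    = refl
  monomial-* zero    a b (suc n) = zeroʳ a
  monomial-* (suc k) a b zero    = zeroʳ a
  monomial-* (suc k) a b (suc n) = monomial-* k a b n

  monomial-+ : ∀ k a b n → monomial k a n + monomial k b n ≈ monomial k (a + b) n
  monomial-+ zero    a b zero    = refl
  monomial-+ zero    a b (suc n) = +-identityʳ 0#
  monomial-+ (suc k) a b zero    = +-identityʳ 0#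
  monomial-+ (suc k) a b (suc n) = monomial-+ k a b n

  monomial-0 : ∀ k n → monomial k 0# n ≈ 0#
  monomial-0 zero    zero    = refl
  monomial-0 zero    (suc n) = refl
  monomial-0 (suc k) zero    = refl
  monomial-0 (suc k) (suc n) = monomial-0 k n

  monomial-coeff : ∀ k a n → monomial k a n ≈ (if does (k ℕ.≟ n) then a else 0#)
  monomial-coeff zero    a zero    = refl
  monomial-coeff zero    a (suc n) = refl
  monomial-coeff (suc k) a zero    = refl
  monomial-coeff (suc k) a (suc n) = monomial-coeff k a n

  series-commutativeRing : CommutativeRing c ℓ
  series-commutativeRing = record
    { Carrier = Series
    ; _≈_ = λ p q → ∀ n → p n ≈ q n
    ; _+_ = λ p q n → p n + q n
    ; _*_ = _⊛_
    ; -_  = λ p n → - p n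
    ; 0#  = λ _ → 0#
    ; 1#  = constant 1#
    ; isCommutativeRing = record
      { isRing = record
        { +-isAbelianGroup = record
          { isGroup = record
            { isMonoid = record
              { isSemigroup = record
                { isMagma = record
                  { isEquivalence = record
                    { refl  = λ _ → refl
                    ; sym   = λ p≈q n → sym (p≈q n)
                    ; trans = λ p≈q q≈r n → trans (p≈q n) (q≈r n)
                    }
                  ; ∙-cong = λ p≈q r≈s n → +-cong (p≈q n) (r≈s n)
                  }
                ; assoc = λ p q r n → +-assoc (p n) (q n) (r n)
                }
              ; identity = (λ p n → +-identityˡ (p n)) , (λ p n → +-identityʳ (p n))
              }
            ; inverse = (λ p n → -‿inverseˡ (p n)) , (λ p n → -‿inverseʳ (p n))
            ; ⁻¹-cong = λ p≈q n → -‿cong (p≈q n)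
            }
          ; comm = λ p q n → +-comm (p n) (q n)
          }
        ; *-cong = λ {p} {p′} {q} {q′} → ⊛-cong {p} {p′} {q} {q′}
        ; *-assoc = ⊛-assoc
        ; *-identity = ⊛-identityˡ , (λ q n → trans (⊛-comm q (constant 1#) n) (⊛-identityˡ q n))
        ; distrib =
            (λ q p p′ n → trans (⊛-comm q (λ i → p i + p′ i) n)
              (trans (⊛-distribʳ q p p′ n) (+-cong (⊛-comm p q n) (⊛-comm p′ q n))))
          , ⊛-distribʳ
        }
      ; *-comm = ⊛-comm
      }
    }
    where
    ⊛-identityˡ : ∀ q n → (constant 1# ⊛ q) n ≈ q n
    ⊛-identityˡ q n = trans (constant-⊛ 1# q n) (*-identityˡ (q n))

-- Sums of principal minors as coefficients of a determinant over power series.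

module PrincipalMinorSums {c ℓ} (K : CommutativeRing c ℓ) where
  open CommutativeRing K hiding (zero)
  open PowerSeries K
  private
    module S = CommutativeRing series-commutativeRing
    module SS = SemiringSum S.semiring
    module SM = Scalars series-commutativeRing
    module SD = Determinant series-commutativeRing
    module SE = Expansion series-commutativeRing
    module SC = Cramer series-commutativeRing
  open Scalars K
  open Determinant K using (sgn; minor₀; sum-zero)
  open Expansion K using (∑ₛ; ∑ₛ-cong)
  open SemiringSum semiring using (sum; sum-cong-≋)
  open RingProperties ring using (-1*x≈-x; -0#≈0#)
  open SetoidReasoning setoid

  sum-coeff : ∀ {m} (f : Fin m → Series) n → SS.sum f n ≈ sum (λ i → f i n)
  sum-coeff {zero}  f n = refl
  sum-coeff {suc m} f n = +-congˡ (sum-coeff (f ∘ suc) n)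

  ∑ₛ-coeff : ∀ {m} (f : Subset m → Series) n → SE.∑ₛ f n ≈ ∑ₛ (λ α → f α n)
  ∑ₛ-coeff {zero}  f n = refl
  ∑ₛ-coeff {suc m} f n = +-cong (∑ₛ-coeff (f ∘ (inside Vec.∷_)) n) (∑ₛ-coeff (f ∘ (outside Vec.∷_)) n)

  sum-monomial : ∀ {m} k (f : Vector Carrier m) → SS.sum (λ i → monomial k (f i)) S.≈ monomial k (sum f)
  sum-monomial {zero}  k f n = sym (monomial-0 k n)
  sum-monomial {suc m} k f n =
    trans (+-congˡ (sum-monomial k (f ∘ suc) n)) (monomial-+ k (f zero) (sum (f ∘ suc)) n)

  sgn-constant : ∀ {n} (j : Fin n) → SD.sgn j S.≈ constant (sgn j)
  sgn-constant zero    = S.refl {constant 1#}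
  sgn-constant (suc j) n = begin
    ((S.- S.1#) ⊛ SD.sgn j) n              ≈⟨ ⊛-cong -1-constant (sgn-constant j) n ⟩
    (constant (- 1#) ⊛ constant (sgn j)) n ≈⟨ constant-⊛ (- 1#) (constant (sgn j)) n ⟩
    - 1# * constant (sgn j) n              ≈⟨ monomial-* 0 (- 1#) (sgn j) n ⟩
    constant (- 1# * sgn j) n              ∎
    where
    -1-constant : (S.- S.1#) S.≈ constant (- 1#)
    -1-constant zero    = refl
    -1-constant (suc n) = -0#≈0#

  t*_ : ∀ {n} → Matrix n → SM.Matrix n
  (t* A) x y = shift (constant (A x y))

  det-t* : ∀ {n} (A : Matrix n) → SM.det (t* A) S.≈ monomial n (det A)
  det-t* {zero}  A = S.refl {constant 1#}
  det-t* {suc m} A = S.trans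
    {SM.det (t* A)} {SS.sum (λ j → monomial (suc m) (a j))} {monomial (suc m) (det A)}
    (SS.sum-cong-≋ term) (sum-monomial (suc m) a)
    where
    a : Fin (suc m) → Carrier
    a j = sgn j * A zero j * det (minor₀ A j)

    term : ∀ j → SD.sgn j ⊛ shift (constant (A zero j)) ⊛ SM.det (t* (minor₀ A j)) S.≈
                 monomial (suc m) (a j)
    term j n = begin
      (SD.sgn j ⊛ shift (constant (A zero j)) ⊛ SM.det (t* (minor₀ A j))) n
        ≈⟨ ⊛-cong (λ n → begin
             (SD.sgn j ⊛ shift (constant (A zero j))) n
               ≈⟨ ⊛-cong (sgn-constant j) (λ _ → refl) n ⟩
             (constant (sgn j) ⊛ shift (constant (A zero j))) n
               ≈⟨ constant-⊛ (sgn j) (shift (constant (A zero j))) n ⟩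
             sgn j * monomial 1 (A zero j) n
               ≈⟨ monomial-* 1 (sgn j) (A zero j) n ⟩
             shift (constant (sgn j * A zero j)) n ∎) (det-t* (minor₀ A j)) n ⟩
      (shift (constant (sgn j * A zero j)) ⊛ monomial m (det (minor₀ A j))) n
        ≈⟨ shift-⊛ (constant (sgn j * A zero j)) (monomial m (det (minor₀ A j))) n ⟩
      shift (constant (sgn j * A zero j) ⊛ monomial m (det (minor₀ A j))) n
        ≈⟨ shift-cong (λ n → trans (constant-⊛ (sgn j * A zero j) (monomial m (det (minor₀ A j))) n)
                                   (monomial-* m (sgn j * A zero j) (det (minor₀ A j)) n)) n ⟩
      monomial (suc m) (a j) n ∎

  -- The outer test comes from `det-I+`, the inner one from extracting the coefficient of t^k from a
  -- monomial of degree `∣ α ∣`.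
  minorSum : ∀ {v} → Matrix v → ℕ → Fin v → Fin v → Carrier
  minorSum A k x y = ∑ₛ λ α →
    if does ((x , y) ∈×∈? α) then (if does (∣ α ∣ ℕ.≟ k) then det (A [ α ]) else 0#) else 0#

  module _ {v} (A : Matrix v) where

    B : SM.Matrix v
    B x y = SM.I x y S.+ (t* A) x y

    -- The coefficients of t A (I + t A)⁻¹.
    W : ℕ → Matrix v
    W zero    = A
    W (suc n) = (- 1#) • (W n *ᴹ A)

    -- The shift accounts for the leading factor t: `W n` is (-1)^n A^(n+1), the coefficient of
    -- t^(n+1).
    H : SM.Matrix v
    H x y = shift (λ n → W n x y)

    -- The product of H and `I + tA` telescopes: by the recursion for `W`, the contribution of tA to
    -- each coefficient cancels that of I, except at t, where `W zero` = A remains.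
    t*A∈Row : ∀ x → (t* A) x SC.∈Row B by H x
    t*A∈Row x y n = sym (begin
      SS.sum (λ z → H x z ⊛ B z y) n
        ≈⟨ SS.sum-cong-≋ (λ z → S.distribˡ (H x z) (SM.I z y) ((t* A) z y)) n ⟩
      SS.sum (λ z n → (H x z ⊛ SM.I z y) n + (H x z ⊛ (t* A) z y) n) n
        ≈⟨ SS.∑-distrib-+ (λ z → H x z ⊛ SM.I z y) (λ z → H x z ⊛ (t* A) z y) n ⟩
      SS.sum (λ z → H x z ⊛ SM.I z y) n + SS.sum (λ z → H x z ⊛ (t* A) z y) n
        ≈⟨ +-cong (HI n) (HA n) ⟩
      H x y n + shift (λ n → sum (λ z → H x z n * A z y)) n
        ≈⟨ cancel n ⟩
      shift (constant (A x y)) n ∎)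
      where
      HI : SS.sum (λ z → H x z ⊛ SM.I z y) S.≈ H x y
      HI n = trans
        (SD.sum-only y (λ z z≢y → S.trans {H x z ⊛ SM.I z y} {H x z ⊛ S.0#} {S.0#}
          (S.*-congˡ {H x z} (SE.I-off z≢y)) (S.zeroʳ (H x z))) n)
        (S.trans {H x y ⊛ SM.I y y} {H x y ⊛ S.1#} {H x y} (S.*-congˡ {H x y} (SE.I-diag y))
          (S.*-identityʳ (H x y)) n)

      HA : SS.sum (λ z → H x z ⊛ (t* A) z y) S.≈ shift (λ n → sum (λ z → H x z n * A z y))
      HA n = trans (sum-coeff (λ z → H x z ⊛ (t* A) z y) n)
        (trans (sum-cong-≋ λ z → trans (⊛-comm (H x z) ((t* A) z y) n)
                 (shift-⊛ (constant (A z y)) (H x z) n))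
               (sum-shift n))
        where
        sum-shift : ∀ n → sum (λ z → shift (constant (A z y) ⊛ H x z) n) ≈
                          shift (λ n → sum (λ z → H x z n * A z y)) n
        sum-shift zero    = sum-zero {v} (λ _ → refl)
        sum-shift (suc n) = sum-cong-≋ λ z → trans (constant-⊛ (A z y) (H x z) n) (*-comm _ _)

      cancel : ∀ n → H x y n + shift (λ n → sum (λ z → H x z n * A z y)) n ≈ shift (constant (A x y)) n
      cancel zero          = +-identityʳ 0#
      cancel (suc zero)    = trans (+-congˡ (sum-zero {v} λ z → zeroˡ (A z y))) (+-identityʳ _)
      cancel (suc (suc n)) = trans (+-congʳ (-1*x≈-x _)) (-‿inverseˡ _)

    Δ : Fin v → Fin v → Series
    Δ x y = H x x ⊛ H y y S.- H x y ⊛ H y x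

    -- Putting rows of tA into B amounts to zeroing the same rows of its identity part, the form
    -- that `det-I+` expands; each principal minor of tA is a monomial of degree `∣ α ∣`.
    minorSum-det : ∀ k x y →
      SM.det (SD._[_≔_] (SD._[_≔_] B x ((t* A) x)) y ((t* A) y)) k ≈ minorSum A k x y
    minorSum-det k x y = begin
      SM.det (SD._[_≔_] (SD._[_≔_] B x ((t* A) x)) y ((t* A) y)) k
        ≈⟨ SD.det-cong rows k ⟩
      SM.det (λ i j → SD._[_≔_] (SD._[_≔_] SM.I x (const S.0#)) y (const S.0#) i j S.+ (t* A) i j) k
        ≈⟨ SE.det-I+ x y (t* A) k ⟩
      SE.∑ₛ (λ α → if does ((x , y) ∈×∈? α) then SM.det (t* (A [ α ])) else S.0#) k
        ≈⟨ ∑ₛ-coeff (λ α → if does ((x , y) ∈×∈? α) then SM.det (t* (A [ α ])) else S.0#) k ⟩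
      ∑ₛ (λ α → (if does ((x , y) ∈×∈? α) then SM.det (t* (A [ α ])) else S.0#) k)
        ≈⟨ ∑ₛ-cong term ⟩
      minorSum A k x y ∎
      where
      term : ∀ α → (if does ((x , y) ∈×∈? α) then SM.det (t* (A [ α ])) else S.0#) k ≈
                   (if does ((x , y) ∈×∈? α) then (if does (∣ α ∣ ℕ.≟ k) then det (A [ α ]) else 0#) else 0#)
      term α with does ((x , y) ∈×∈? α)
      ... | true  = trans (det-t* (A [ α ]) k) (monomial-coeff ∣ α ∣ (det (A [ α ])) k)
      ... | false = refl

      rows : SD._[_≔_] (SD._[_≔_] B x ((t* A) x)) y ((t* A) y) SM.≈ᴹ
             (λ i j → SD._[_≔_] (SD._[_≔_] SM.I x (const S.0#)) y (const S.0#) i j S.+ (t* A) i j)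
      rows i j n with i Fin.≟ y
      ... | yes ≡.refl
        rewrite updateAt-updates y {const ((t* A) y)} (SD._[_≔_] B x ((t* A) x))
              | updateAt-updates y {const (const S.0#)} (SD._[_≔_] SM.I x (const S.0#)) = sym (+-identityˡ _)
      ... | no i≢y
        rewrite updateAt-minimal i y {const ((t* A) y)} (SD._[_≔_] B x ((t* A) x)) i≢y
              | updateAt-minimal i y {const (const S.0#)} (SD._[_≔_] SM.I x (const S.0#)) i≢y
        with i Fin.≟ x
      ... | yes ≡.refl
        rewrite updateAt-updates x {const ((t* A) x)} B
              | updateAt-updates x {const (const S.0#)} SM.I = sym (+-identityˡ _)
      ... | no i≢x
        rewrite updateAt-minimal i x {const ((t* A) x)} B i≢x
              | updateAt-minimal i x {const (const S.0#)} SM.I i≢x = refl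

    minorSum-diag : ∀ k x → minorSum A k x x ≈ (H x x ⊛ SM.det B) k
    minorSum-diag k x = trans (sym (minorSum-det k x x)) (trans
      (SD.det-cong (λ i → SD.≡⇒≋ (updateAt-updateAt x {const ((t* A) x)} {const ((t* A) x)} B i)) k)
      (SC.cramer B {(t* A) x} {H x} (t*A∈Row x) x k))

    minorSum-off : ∀ k {x y} → x ≢ y → minorSum A k x y ≈ (Δ x y ⊛ SM.det B) k
    minorSum-off k {x} {y} x≢y = trans (sym (minorSum-det k x y))
      (SC.cramer₂ B {(t* A) x} {H x} {(t* A) y} {H y} (t*A∈Row x) (t*A∈Row y) x≢y k)

    minorSum-cong-diag : ∀ k {x x′} → (∀ n → W n x x ≈ W n x′ x′) → minorSum A k x x ≈ minorSum A k x′ x′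
    minorSum-cong-diag k {x} {x′} xx = trans (minorSum-diag k x)
      (trans (⊛-cong {q = SM.det B} (shift-cong xx) (λ _ → refl) k) (sym (minorSum-diag k x′)))

    -- Both sides are a 2 by 2 minor of H times the same series det B, so agreement of the entries
    -- of H is enough.
    minorSum-cong-off : ∀ k {x y x′ y′} → x ≢ y → x′ ≢ y′ →
      (∀ n → W n x x ≈ W n x′ x′) → (∀ n → W n y y ≈ W n y′ y′) →
      (∀ n → W n x y ≈ W n x′ y′) → (∀ n → W n y x ≈ W n y′ x′) →
      minorSum A k x y ≈ minorSum A k x′ y′
    minorSum-cong-off k {x} {y} {x′} {y′} x≢y x′≢y′ xx yy xy yx = trans (minorSum-off k x≢y)
      (trans (⊛-cong {q = SM.det B} (λ n → +-cong
                (⊛-cong (shift-cong xx) (shift-cong yy) n)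
                (-‿cong (⊛-cong (shift-cong xy) (shift-cong yx) n))) (λ _ → refl) k)
             (sym (minorSum-off k x′≢y′)))

-- Enumerating subsets and counting.

subsets : ∀ n → List (Subset n)
subsets zero    = Vec.[] ∷ []
subsets (suc n) = map (inside Vec.∷_) (subsets n) ++ map (outside Vec.∷_) (subsets n)

∈-subsets : ∀ {n} (α : Subset n) → α List.∈ subsets n
∈-subsets Vec.[]              = here ≡.refl
∈-subsets (inside  Vec.∷ α) = ∈-++⁺ˡ (∈-map⁺ (inside Vec.∷_) (∈-subsets α))
∈-subsets (outside Vec.∷ α) = ∈-++⁺ʳ _ (∈-map⁺ (outside Vec.∷_) (∈-subsets α))

subsets-unique : ∀ n → Unique (subsets n)
subsets-unique zero    = [] ∷ []
subsets-unique (suc n) = Unique.++⁺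
  (Unique.map⁺ ∷-injectiveʳ (subsets-unique n)) (Unique.map⁺ ∷-injectiveʳ (subsets-unique n)) disjoint
  where
  disjoint : ∀ {α} → α List.∈ map (inside Vec.∷_) (subsets n) ×
                     α List.∈ map (outside Vec.∷_) (subsets n) → ⊥
  disjoint (α∈ , α∈′) with ∈-map⁻ (inside Vec.∷_) α∈ | ∈-map⁻ (outside Vec.∷_) α∈′
  ... | _ , _ , ≡.refl | _ , _ , ()

length-filter-map : ∀ {a b p} {A : Set a} {B : Set b} {P : Pred B p} (P? : Decidable P) (f : A → B) xs →
                    length (filter P? (map f xs)) ≡ length (filter (P? ∘ f) xs)
length-filter-map P? f []       = ≡.refl
length-filter-map P? f (x ∷ xs) with does (P? (f x))
... | true  = ≡.cong suc (length-filter-map P? f xs)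
... | false = length-filter-map P? f xs

count : ∀ {n} → (Fin n → Bool) → ℕ
count {zero}  b = 0
count {suc n} b = (if b zero then 1 else 0) ℕ.+ count (b ∘ suc)

count≢0 : ∀ {n} (b : Fin n → Bool) {i} → b i ≡ true → count b ≢ 0
count≢0 b {zero}  bi eq rewrite bi = contradiction eq λ ()
count≢0 b {suc i} bi eq = count≢0 (b ∘ suc) bi (ℕ.m+n≡0⇒n≡0 _ eq)

count≡1 : ∀ {n} (b : Fin n → Bool) → count b ≡ 1 → ∀ {i j} → b i ≡ true → b j ≡ true → i ≡ j
count≡1 b eq {zero}  {zero}  _  _  = ≡.refl
count≡1 b eq {zero}  {suc j} bi bj rewrite bi = contradiction (ℕ.suc-injective eq) (count≢0 (b ∘ suc) bj)
count≡1 b eq {suc i} {zero}  bi bj rewrite bj = contradiction (ℕ.suc-injective eq) (count≢0 (b ∘ suc) bi)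
count≡1 b eq {suc i} {suc j} bi bj with b zero
... | true  = contradiction (ℕ.suc-injective eq) (count≢0 (b ∘ suc) bi)
... | false = ≡.cong suc (count≡1 (b ∘ suc) eq bi bj)

-- From identities in the ring to numbers of hyperedges.

module _ {c ℓ} (K : CommutativeRing c ℓ) where
  open CommutativeRing K using (_≈_; 0#; semiring)
  open SemiringMult semiring using () renaming (_×_ to _·_)

  -- Lets natural numbers be recovered from ring equations: multiples of a - b give the degrees, and
  -- multiples of `1#` the number of relations holding at a pair.
  TorsionFree : Set (c ⊔ ℓ)
  TorsionFree = ∀ n x → suc n · x ≈ 0# → x ≈ 0#

module Design {c ℓ} (K : CommutativeRing c ℓ) (torsionFree : TorsionFree K)
  (1≉0 : ¬ (CommutativeRing._≈_ K (CommutativeRing.1# K) (CommutativeRing.0# K))) where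
  open CommutativeRing K hiding (zero)
  open Scalars K
  open Expansion K
  open PrincipalMinorSums K
  open SemiringSum semiring using (sum; sum-cong-≋; ∑-distrib-+; *-distribˡ-sum)
  open SemiringMult semiring using () renaming (_×_ to _·_; ×-homo-+ to ·-homo-+)
  open AbelianGroupProperties +-abelianGroup using (∙-cancelˡ; x∙y⁻¹≈ε⇒x≈y)
  open SetoidReasoning setoid
  open RingSolver commutativeSemiring using (solve; _:=_; _:+_; _:*_)

  ·-cancelʳ : ∀ {x} → ¬ x ≈ 0# → ∀ m n → m · x ≈ n · x → m ≡ n
  ·-cancelʳ x≉0 zero    zero    eq = ≡.refl
  ·-cancelʳ x≉0 zero    (suc n) eq = contradiction (torsionFree n _ (sym eq)) x≉0
  ·-cancelʳ x≉0 (suc m) zero    eq = contradiction (torsionFree m _ eq) x≉0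
  ·-cancelʳ x≉0 (suc m) (suc n) eq = ≡.cong suc (·-cancelʳ x≉0 m n (∙-cancelˡ _ _ _ eq))

  sum-indicator : ∀ {n} (b : Fin n → Bool) → sum (λ i → if b i then 1# else 0#) ≈ count b · 1#
  sum-indicator {zero}  b = refl
  sum-indicator {suc n} b with b zero
  ... | true  = +-congˡ (sum-indicator (b ∘ suc))
  ... | false = trans (+-identityˡ _) (sum-indicator (b ∘ suc))

  *ᴹ-cong : ∀ {n} {M M′ N N′ : Matrix n} → M ≈ᴹ M′ → N ≈ᴹ N′ → M *ᴹ N ≈ᴹ M′ *ᴹ N′
  *ᴹ-cong M≈ N≈ x y = sum-cong-≋ λ z → *-cong (M≈ x z) (N≈ z y)

  *ᴹ-distribˡ : ∀ {n} (M N P : Matrix n) → M *ᴹ N +ᴹ M *ᴹ P ≈ᴹ M *ᴹ (N +ᴹ P)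
  *ᴹ-distribˡ M N P x y = trans (sym (∑-distrib-+ (λ z → M x z * N z y) (λ z → M x z * P z y)))
    (sum-cong-≋ λ z → sym (distribˡ (M x z) (N z y) (P z y)))

  *ᴹ-distribʳ : ∀ {n} (M N P : Matrix n) → N *ᴹ M +ᴹ P *ᴹ M ≈ᴹ (N +ᴹ P) *ᴹ M
  *ᴹ-distribʳ M N P x y = trans (sym (∑-distrib-+ (λ z → N x z * M z y) (λ z → P x z * M z y)))
    (sum-cong-≋ λ z → sym (distribʳ (M z y) (N x z) (P x z)))

  *ᴹ-•ʳ : ∀ {n} a (M N : Matrix n) → a • (M *ᴹ N) ≈ᴹ M *ᴹ (a • N)
  *ᴹ-•ʳ a M N x y = trans (*-distribˡ-sum a (λ z → M x z * N z y))
    (sum-cong-≋ λ z → solve 3 (λ a b e → a :* (b :* e) := b :* (a :* e)) refl a (M x z) (N z y))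

  *ᴹ-•ˡ : ∀ {n} a (M N : Matrix n) → a • (M *ᴹ N) ≈ᴹ (a • M) *ᴹ N
  *ᴹ-•ˡ a M N x y = trans (*-distribˡ-sum a (λ z → M x z * N z y))
    (sum-cong-≋ λ z → sym (*-assoc a (M x z) (N z y)))

  ∑ₛ-linear : ∀ {n} a (f g : Subset n → Carrier) → ∑ₛ (λ α → f α + a * g α) ≈ ∑ₛ f + a * ∑ₛ g
  ∑ₛ-linear {zero}  a f g = refl
  ∑ₛ-linear {suc n} a f g = trans (+-cong (∑ₛ-linear a f₁ g₁) (∑ₛ-linear a f₀ g₀))
    (solve 5 (λ a f g f′ g′ → f :+ a :* g :+ (f′ :+ a :* g′) := f :+ f′ :+ a :* (g :+ g′)) refl a
       (∑ₛ f₁) (∑ₛ g₁) (∑ₛ f₀) (∑ₛ g₀))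
    where
    f₁ = f ∘ (inside Vec.∷_)
    g₁ = g ∘ (inside Vec.∷_)
    f₀ = f ∘ (outside Vec.∷_)
    g₀ = g ∘ (outside Vec.∷_)

  ∑ₛ-filter : ∀ {p n} {P : Pred (Subset n) p} (P? : Decidable P) a →
              ∑ₛ (λ α → if does (P? α) then a else 0#) ≈ length (filter P? (subsets n)) · a
  ∑ₛ-filter {n = zero}  P? a with does (P? Vec.[])
  ... | true  = sym (+-identityʳ a)
  ... | false = refl
  ∑ₛ-filter {n = suc n} P? a = begin
    ∑ₛ (λ α → if does (P? α) then a else 0#) ≈⟨ +-cong (∑ₛ-filter P?₁ a) (∑ₛ-filter P?₀ a) ⟩
    length xs₁ · a + length xs₀ · a          ≈⟨ ·-homo-+ a (length xs₁) (length xs₀) ⟨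
    (length xs₁ ℕ.+ length xs₀) · a          ≡⟨ ≡.cong (_· a) lengths ⟩
    length (filter P? (subsets (suc n))) · a ∎
    where
    P?₁ = P? ∘ (inside Vec.∷_)
    P?₀ = P? ∘ (outside Vec.∷_)
    xs₁ = filter P?₁ (subsets n)
    xs₀ = filter P?₀ (subsets n)
    ys₁ = map (inside Vec.∷_) (subsets n)
    ys₀ = map (outside Vec.∷_) (subsets n)

    lengths : length xs₁ ℕ.+ length xs₀ ≡ length (filter P? (ys₁ ++ ys₀))
    lengths = ≡.sym (≡.trans (≡.cong length (filter-++ P? ys₁ ys₀))
      (≡.trans (length-++ (filter P? ys₁))
        (≡.cong₂ ℕ._+_ (length-filter-map P? (inside Vec.∷_) (subsets n))
                       (length-filter-map P? (outside Vec.∷_) (subsets n)))))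

  module _ {v d} (𝒳 : SymmetricScheme v d) where
    open SymmetricScheme 𝒳

    -- `partition` is an equation in the ring: the image of the number of relations holding at (x ,
    -- y) is one. Torsion-freeness turns it into an equation of natural numbers.
    R-unique : ∀ {x y i j} → R i x y ≡ true → R j x y ≡ true → i ≡ j
    R-unique {x} {y} = count≡1 (λ i → R i x y) (·-cancelʳ 1≉0 _ 1
      (trans (sym (sum-indicator (λ i → R i x y))) (trans (partition x y) (sym (+-identityʳ 1#)))))

    indicator-true : ∀ {b} → (if b then 1# else 0#) ≈ 1# → b ≡ true
    indicator-true {true}  _   = ≡.refl
    indicator-true {false} 0≈1 = contradiction (sym 0≈1) 1≉0

    R₀-refl : ∀ x → R zero x x ≡ true
    R₀-refl x = indicator-true (trans (diagonal x x) (I-diag x))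

    R₀⇒≡ : ∀ {x y} → R zero x y ≡ true → x ≡ y
    R₀⇒≡ {x} {y} Rxy with x Fin.≟ y
    ... | yes x≡y = x≡y
    ... | no x≢y  = contradiction
      (trans (reflexive (≡.cong (λ b → if b then 1# else 0#) (≡.sym Rxy)))
             (trans (diagonal x y) (I-off x≢y))) 1≉0

    -- The linear span, without a constructor for products: symmetry and constancy on relations pass
    -- to linear combinations but not to products of arbitrary matrices. Closure under products is
    -- proved separately from `product`.
    data Span : Matrix v → Set (c ⊔ ℓ) where
      gen  : ∀ i → Span (Adj i)
      add  : ∀ {M N} → Span M → Span N → Span (M +ᴹ N)
      scal : ∀ a {M} → Span M → Span (a • M)
      resp : ∀ {M N} → M ≈ᴹ N → Span M → Span N

    -- The sum is nonempty so that the base case is a multiple of a generator; the reindexing f lets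
    -- the recursion drop the first index.
    span-∑ : ∀ {m} (q : Fin (suc m) → Carrier) (f : Fin (suc m) → Fin (suc d)) →
             Span (∑ᴹ (λ h → q h • Adj (f h)))
    span-∑ {zero}  q f = resp (λ x y → sym (+-identityʳ _)) (scal (q zero) (gen (f zero)))
    span-∑ {suc m} q f = add (scal (q zero) (gen (f zero))) (span-∑ (q ∘ suc) (f ∘ suc))

    span-Adj-* : ∀ i {N} → Span N → Span (Adj i *ᴹ N)
    span-Adj-* i (gen j) = let q , AA≈ = product i j in resp (λ x y → sym (AA≈ x y)) (span-∑ q (λ h → h))
    span-Adj-* i (add M N)   = resp (*ᴹ-distribˡ (Adj i) _ _) (add (span-Adj-* i M) (span-Adj-* i N))
    span-Adj-* i (scal a N)  = resp (*ᴹ-•ʳ a (Adj i) _) (scal a (span-Adj-* i N))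
    span-Adj-* i (resp M≈N M) = resp (*ᴹ-cong (λ _ _ → refl) M≈N) (span-Adj-* i M)

    span-* : ∀ {M N} → Span M → Span N → Span (M *ᴹ N)
    span-* (gen i)       N = span-Adj-* i N
    span-* (add M M′)    N = resp (*ᴹ-distribʳ _ _ _) (add (span-* M N) (span-* M′ N))
    span-* (scal a M)    N = resp (*ᴹ-•ˡ a _ _) (scal a (span-* M N))
    span-* (resp M≈M′ M) N = resp (*ᴹ-cong M≈M′ (λ _ _ → refl)) (span-* M N)

    boseMesner⇒span : ∀ {M} → BoseMesner 𝒳 M → Span M
    boseMesner⇒span (gen i)      = gen i
    boseMesner⇒span (add M N)    = add (boseMesner⇒span M) (boseMesner⇒span N)
    boseMesner⇒span (mul M N)    = span-* (boseMesner⇒span M) (boseMesner⇒span N)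
    boseMesner⇒span (scal a M)   = scal a (boseMesner⇒span M)
    boseMesner⇒span (resp M≈N M) = resp M≈N (boseMesner⇒span M)

    span-symmetric : ∀ {M} → Span M → ∀ x y → M x y ≈ M y x
    span-symmetric (gen i)      x y = symmetric i y x
    span-symmetric (add M N)    x y = +-cong (span-symmetric M x y) (span-symmetric N x y)
    span-symmetric (scal a M)   x y = *-congˡ (span-symmetric M x y)
    span-symmetric (resp M≈N M) x y = trans (sym (M≈N x y)) (trans (span-symmetric M x y) (M≈N y x))

    module _ {i x y x′ y′} (Rxy : R i x y ≡ true) (Rxy′ : R i x′ y′ ≡ true) where

      span-constant : ∀ {M} → Span M → M x y ≈ M x′ y′
      span-constant (gen j) with R j x y in eq | R j x′ y′ in eq′
      ... | true  | true  = refl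
      ... | false | false = refl
      ... | true  | false rewrite R-unique Rxy eq = contradiction (≡.trans (≡.sym Rxy′) eq′) λ ()
      ... | false | true  rewrite R-unique Rxy′ eq′ = contradiction (≡.trans (≡.sym Rxy) eq) λ ()
      span-constant (add M N)    = +-cong (span-constant M) (span-constant N)
      span-constant (scal a M)   = *-congˡ (span-constant M)
      span-constant (resp M≈N M) = trans (sym (M≈N x y)) (trans (span-constant M) (M≈N x′ y′))

    span-W : ∀ {A} → Span A → ∀ n → Span (W A n)
    span-W A zero    = A
    span-W A (suc n) = scal (- 1#) (span-* (span-W A n) A)

    minorSum-constant : ∀ {A} → Span A → ∀ k i {x y x′ y′} → R i x y ≡ true → R i x′ y′ ≡ true →
                        minorSum A k x y ≈ minorSum A k x′ y′
    minorSum-constant {A} A∈ k zero    Rxy Rxy′ with R₀⇒≡ Rxy | R₀⇒≡ Rxy′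
    ... | ≡.refl | ≡.refl = minorSum-cong-diag A k λ n → span-constant Rxy Rxy′ (span-W A∈ n)
    minorSum-constant {A} A∈ k (suc i) {x} {y} {x′} {y′} Rxy Rxy′ =
      minorSum-cong-off A k (irrefl Rxy) (irrefl Rxy′)
      (λ n → span-constant (R₀-refl x) (R₀-refl x′) (span-W A∈ n))
      (λ n → span-constant (R₀-refl y) (R₀-refl y′) (span-W A∈ n))
      (λ n → span-constant Rxy Rxy′ (span-W A∈ n))
      -- Symmetry of `W n` reduces the transposed entries to those at (x , y) and (x′ , y′), which
      -- share a relation.
      (λ n → trans (span-symmetric (span-W A∈ n) y x)
        (trans (span-constant Rxy Rxy′ (span-W A∈ n)) (span-symmetric (span-W A∈ n) x′ y′)))
      where
      irrefl : ∀ {x y} → R (suc i) x y ≡ true → x ≢ y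
      irrefl {x} Rxx ≡.refl = contradiction (R-unique Rxx (R₀-refl x)) λ ()

    module TwoValues (A : Matrix v) (A∈ : Span A) (k : ℕ) (1≤k : 1 ≤ k) {a b} (a≉b : ¬ a ≈ b)
      (two-valued : ∀ α → ∣ α ∣ ≡ k → det (A [ α ]) ≈ a ⊎ det (A [ α ]) ≈ b) where

      -- Decidable although equality of scalars need not be: the hypothesis says which value the
      -- determinant has, and b excludes a.
      ℌ? : Decidable (ℌ A k a)
      ℌ? α with ∣ α ∣ ℕ.≟ k
      ... | no ∣α∣≢k = no (∣α∣≢k ∘ proj₁)
      ... | yes ∣α∣≡k with two-valued α ∣α∣≡k
      ...   | inj₁ det≈a = yes (∣α∣≡k , det≈a)
      ...   | inj₂ det≈b = no λ (_ , det≈a) → a≉b (trans (sym det≈a) det≈b)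

      through : ∀ x y → Decidable (λ α → (x ∈ α × y ∈ α) × ℌ A k a α)
      through x y α = ((x , y) ∈×∈? α) ×-dec ℌ? α

      degree : Fin v → Fin v → ℕ
      degree x y = length (filter (through x y) (subsets v))

      hyperedges-through : ∀ x y → HyperedgesWith (ℌ A k a) (λ α → x ∈ α × y ∈ α) (degree x y)
      hyperedges-through x y = filter (through x y) (subsets v)
        , Unique.filter⁺ (through x y) (subsets-unique v)
        , ≡.refl
        , λ α → mk⇔ (λ (h , xy∈) → ∈-filter⁺ (through x y) (∈-subsets α) (xy∈ , h))
                    (λ α∈ → let _ , xy∈ , h = ∈-filter⁻ (through x y) {xs = subsets v} α∈ in h , xy∈)

      -- minorSum I k x y is the number of all k-subsets containing x and y.
      degree-minorSum : ∀ x y → degree x y · (a - b) ≈ minorSum A k x y + - b * minorSum I k x y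
      degree-minorSum x y = begin
        degree x y · (a - b) ≈⟨ ∑ₛ-filter (through x y) (a - b) ⟨
        ∑ₛ (λ α → if does (through x y α) then a - b else 0#) ≈⟨ ∑ₛ-cong term ⟩
        ∑ₛ (λ α → f A α + - b * f I α) ≈⟨ ∑ₛ-linear (- b) (f A) (f I) ⟩
        minorSum A k x y + - b * minorSum I k x y ∎
        where
        f : Matrix v → Subset v → Carrier
        f M α = if does ((x , y) ∈×∈? α) then (if does (∣ α ∣ ℕ.≟ k) then det (M [ α ]) else 0#) else 0#

        det-I[] : ∀ α → det (I [ α ]) ≈ 1#
        det-I[] α = trans
          (Determinant.det-cong K {M = I [ α ]} {I} (I-∘ (element α) (element-injective α)))
          (det-I {∣ α ∣})

        0≈0-b0 : 0# ≈ 0# + - b * 0#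
        0≈0-b0 = sym (trans (+-identityˡ _) (zeroʳ _))

        det-b : ∀ α {a} → det (A [ α ]) ≈ a → a - b ≈ det (A [ α ]) + - b * det (I [ α ])
        det-b α det≈a = +-cong (sym det≈a) (sym (trans (*-congˡ (det-I[] α)) (*-identityʳ (- b))))

        term-k : ∀ α (size? : Dec (∣ α ∣ ≡ k)) (h? : Dec (ℌ A k a α)) →
                 (if does h? then a - b else 0#) ≈
                 (if does size? then det (A [ α ]) else 0#) +
                 - b * (if does size? then det (I [ α ]) else 0#)
        term-k α (no _)      (no _)            = 0≈0-b0
        term-k α (no ∣α∣≢k)  (yes (∣α∣≡k , _)) = contradiction ∣α∣≡k ∣α∣≢k
        term-k α (yes _)     (yes (_ , det≈a)) = det-b α det≈a
        term-k α (yes ∣α∣≡k) (no α∉ℌ) with two-valued α ∣α∣≡k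
        ... | inj₁ det≈a = contradiction (∣α∣≡k , det≈a) α∉ℌ
        ... | inj₂ det≈b = trans (sym (-‿inverseʳ b)) (det-b α det≈b)

        term : ∀ α → (if does (through x y α) then a - b else 0#) ≈ f A α + - b * f I α
        term α with does ((x , y) ∈×∈? α)
        ... | false = 0≈0-b0
        ... | true  = term-k α (∣ α ∣ ℕ.≟ k) (ℌ? α)

      -- Makes the subtracted count of all k-subsets through x and y another instance of
      -- `minorSum-constant`, so no binomial coefficient has to be evaluated.
      I∈ : Span I
      I∈ = resp diagonal (gen zero)

      degree-constant : ∀ i {x y x′ y′} → R i x y ≡ true → R i x′ y′ ≡ true → degree x y ≡ degree x′ y′
      degree-constant i {x} {y} {x′} {y′} Rxy Rxy′ =
        ·-cancelʳ (a≉b ∘ x∙y⁻¹≈ε⇒x≈y a b) (degree x y) (degree x′ y′) (begin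
          degree x y · (a - b)                            ≈⟨ degree-minorSum x y ⟩
          minorSum A k x y + - b * minorSum I k x y
            ≈⟨ +-cong (minorSum-constant A∈ k i Rxy Rxy′) (*-congˡ (minorSum-constant I∈ k i Rxy Rxy′)) ⟩
          minorSum A k x′ y′ + - b * minorSum I k x′ y′   ≈⟨ degree-minorSum x′ y′ ⟨
          degree x′ y′ · (a - b)                          ∎)

      -- The degree of a point is the degree of its diagonal pair, and all diagonal pairs lie in R₀.
      -- It is positive because a is attained at some α, which has a point since 1 ≤ k.
      isOneDesign : D A k a → IsOneDesign (ℌ A k a)
      isOneDesign (α , ∣α∣≡k , det≈a) with nonempty? α
      ... | no empty = contradiction
        (≡.subst (1 ≤_) (≡.trans (≡.sym ∣α∣≡k)
          (≡.trans (≡.cong ∣_∣ (Empty-unique empty)) (∣⊥∣≡0 v))) 1≤k) λ ()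
      ... | yes (x , x∈α) = record
        { r           = degree x x
        ; r>0         = nonempty-length
            (∈-filter⁺ (through x x) (∈-subsets α) ((x∈α , x∈α) , ∣α∣≡k , det≈a))
        ; replication = λ y → let xs , unique , size , member = hyperedges-through y y in
            xs , unique , ≡.trans size (degree-constant zero (R₀-refl y) (R₀-refl x)) , λ α →
              mk⇔ (λ (h , y∈) → Equivalence.to (member α) (h , y∈ , y∈))
                  (λ α∈ → let h , y∈ , _ = Equivalence.from (member α) α∈ in h , y∈)
        }
        where
        nonempty-length : ∀ {xs} → α List.∈ xs → 0 < length xs
        nonempty-length (here _)  = s≤s z≤n
        nonempty-length (there _) = s≤s z≤n

      isPBIBD : D A k a → IsPBIBD 𝒳 (ℌ A k a)
      isPBIBD a∈D = record
        { k           = k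
        ; uniform     = λ _ → proj₁
        ; isOneDesign = isOneDesign a∈D
        -- Any pair in the relation may serve as its representative; `nonempty` supplies one.
        ; Λ           = λ i → let x , y , _ = nonempty (suc i) in degree x y
        ; balanced    = λ i x y Rxy → let x₀ , y₀ , Rx₀y₀ = nonempty (suc i) in
            ≡.subst (HyperedgesWith (ℌ A k a) _) (degree-constant (suc i) Rxy Rx₀y₀)
              (hyperedges-through x y)
        }

  other-value : ∀ {p} {P : Pred Carrier p} → HasSize setoid P 2 → ∀ {a} → P a →
                ∃[ b ] ¬ a ≈ b × (∀ x → P x → x ≈ a ⊎ x ≈ b)
  other-value {P = P} (p ∷ q ∷ [] , (p≉q ∷ []) ∷ _ , ≡.refl , member) {a} Pa
    with Equivalence.to (member a) Pa
  ... | here a≈p = q , (λ a≈q → p≉q (trans (sym a≈p) a≈q)) , λ x Px → cases (Equivalence.to (member x) Px)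
    where
    cases : ∀ {x} → _ → x ≈ a ⊎ x ≈ q
    cases (here x≈p)         = inj₁ (trans x≈p (sym a≈p))
    cases (there (here x≈q)) = inj₂ x≈q
  ... | there (here a≈q) =
    p , (λ a≈p → p≉q (trans (sym a≈p) a≈q)) , λ x Px → cases (Equivalence.to (member x) Px)
    where
    cases : ∀ {x} → _ → x ≈ a ⊎ x ≈ p
    cases (here x≈p)         = inj₂ x≈p
    cases (there (here x≈q)) = inj₁ (trans x≈q (sym a≈q))

-- The Cauchy reals satisfy the conditions imposed on the scalars.

module _ where
  open SemiringMult (CommutativeRing.semiring ℚ.+-*-commutativeRing) using () renaming (_×_ to _·ᵠ_)
  open SemiringMult (CommutativeRing.semiring ℝ-commutativeRing) using () renaming (_×_ to _·ʳ_)

  seq-· : ∀ n x i → seq (n ·ʳ x) i ≡ n ·ᵠ seq x i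
  seq-· zero    x i = ≡.refl
  seq-· (suc n) x i = ≡.cong (seq x i ℚ.+_) (seq-· n x i)

  ·-nonNeg : ∀ n {q} → 0ℚ ℚ.≤ q → 0ℚ ℚ.≤ n ·ᵠ q
  ·-nonNeg zero    0≤q = ℚ.≤-refl
  ·-nonNeg (suc n) 0≤q = ℚ.+-mono-≤ 0≤q (·-nonNeg n 0≤q)

  ·-neg : ∀ n q → n ·ᵠ (ℚ.- q) ≡ ℚ.- (n ·ᵠ q)
  ·-neg zero    q = ≡.refl
  ·-neg (suc n) q = ≡.trans (≡.cong (ℚ.- q ℚ.+_) (·-neg n q)) (≡.sym (ℚ.neg-distrib-+ q (n ·ᵠ q)))

  ∣q∣≤∣1+n·q∣-nonNeg : ∀ n {q} → 0ℚ ℚ.≤ q → ℚ.∣ q ∣ ℚ.≤ ℚ.∣ suc n ·ᵠ q ∣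
  ∣q∣≤∣1+n·q∣-nonNeg n {q} 0≤q = ≡.subst₂ ℚ._≤_
    (≡.sym (ℚ.0≤p⇒∣p∣≡p 0≤q)) (≡.sym (ℚ.0≤p⇒∣p∣≡p (·-nonNeg (suc n) 0≤q)))
    (≡.subst (ℚ._≤ suc n ·ᵠ q) (ℚ.+-identityʳ q) (ℚ.+-monoʳ-≤ q (·-nonNeg n 0≤q)))

  ∣q∣≤∣1+n·q∣ : ∀ n q → ℚ.∣ q ∣ ℚ.≤ ℚ.∣ suc n ·ᵠ q ∣
  ∣q∣≤∣1+n·q∣ n q with ℚ.≤-total 0ℚ q
  ... | inj₁ 0≤q = ∣q∣≤∣1+n·q∣-nonNeg n 0≤q
  ... | inj₂ q≤0 = ≡.subst₂ ℚ._≤_ (ℚ.∣-p∣≡∣p∣ q)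
    (≡.trans (≡.cong ℚ.∣_∣ (·-neg (suc n) q)) (ℚ.∣-p∣≡∣p∣ (suc n ·ᵠ q)))
    (∣q∣≤∣1+n·q∣-nonNeg n (ℚ.neg-antimono-≤ q≤0))

  -- Multiplication by n + 1 does not decrease absolute values of rationals, so the index that works
  -- for the multiple works for x with the same ε.
  ℝ-torsionFree : TorsionFree ℝ-commutativeRing
  ℝ-torsionFree n x nx≃0 .close .approx ε ε>0 =
    let N , h = approx (close nx≃0) ε ε>0 in N , λ i j i≥ j≥ →
      ℚ.≤-<-trans (≡.subst₂ (λ p q → ℚ.∣ p ∣ ℚ.≤ ℚ.∣ q ∣)
          (≡.sym (ℚ.+-identityʳ (seq x i)))
          (≡.trans (≡.sym (seq-· (suc n) x i)) (≡.sym (ℚ.+-identityʳ (seq (suc n ·ʳ x) i))))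
          (∣q∣≤∣1+n·q∣ n (seq x i)))
        (h i j i≥ j≥)

  1ʳ≄0ʳ : ¬ 1ʳ ≃ 0ʳ
  1ʳ≄0ʳ 1≃0 = let N , h = approx (close 1≃0) 1ℚ (ℚ.positive⁻¹ 1ℚ) in
    ℚ.<-irrefl ≡.refl (h N N ℕ.≤-refl ℕ.≤-refl)

open Scalars ℝ-commutativeRing

corollary3p3 : ∀ {v d : ℕ} (𝒳 : SymmetricScheme v d) (A : Matrix v) → BoseMesner 𝒳 A →
    ∀ (k : ℕ) → 1 ≤ k →
    HasSize (CommutativeRing.setoid ℝ-commutativeRing) (D A k) 2 →
    ∀ (a : ℝ) → D A k a → IsPBIBD 𝒳 (ℌ A k a)
corollary3p3 𝒳 A A∈ k 1≤k size₂ a a∈D =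
  let b , a≄b , a-or-b = other-value size₂ a∈D in
  TwoValues.isPBIBD 𝒳 A (boseMesner⇒span 𝒳 A∈) k 1≤k a≄b
    (λ α ∣α∣≡k → a-or-b (det (A [ α ])) (α , ∣α∣≡k , CommutativeRing.refl ℝ-commutativeRing)) a∈D
  where open Design ℝ-commutativeRing ℝ-torsionFree 1ʳ≄0ʳ
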